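{- The bijections $\psi:\mathrm{revSSYT}\to\mathrm{qKT}^{(1)}$ and $\Gamma:\mathrm{revSSYT}\to\mathcal{A}\mathrm{SSF}$ restrict to bijections $\mathrm{QrevSSYT}\to\mathrm{QqKT}^{(1)}$ and $\mathrm{QrevSSYT}\to\mathrm{QSSF}$ respectively.
   Context: $\mathrm{revSSYT}$: reverse semistandard Young tableaux of all partition shapes (English notation; positive integer entries; rows weakly decrease left to right, columns strictly decrease top to bottom). For a weak composition $a$, $D(a)$ has $a_i$ left-justified boxes in row $i$, row 1 lowest. Quasi-key tableau of shape $a$: filling of $D(a)$ with positive integers such that (1) rows weakly decrease and no entry of row $i$ exceeds $i$; (2) column entries distinct, increasing going up the first column; (3) if $i$ is above $k$ in a column with $i<k$, there is an entry $j>i$ immediately right of $k$; (4) for two rows with the higher strictly longer, an entry $i$ in column $c$ of the lower and $j$ in column $c+1$ of the higher satisfy $i<j$. $\mathrm{qKT}^{(1)}$: all quasi-key tableaux (all shapes) with first-column entries equal to row indices. Triples of $D(a)$ (rows $r<s$): Type A: $\gamma=(r,c),\alpha=(r,c+1),\beta=(s,c+1)$, $a_r\ge a_s$; Type B: $\gamma=(s,c),\alpha=(s,c+1),\beta=(r,c)$, $a_s>a_r$; inversion triple: $\beta>\gamma\ge\alpha$ or $\gamma\ge\alpha>\beta$. $\mathcal{A}\mathrm{SSF}$: all fillings of skyline diagrams $D(a)$ (all $a$) with positive integers, rows weakly decreasing, distinct column entries, all triples inversion triples, first-column entry of each nonempty row $i$ equal to $i$. $\psi$ (right row-filling): with column sets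 $C_1,C_2,\ldots$ of $V$, repeatedly let $k$ be the largest index with $C_k\neq\emptyset$, choose the smallest $y_k\in C_k$, then for $c=k-1,\ldots,1$ the smallest $y_c\in C_c$ with $y_c\ge y_{c+1}$; make $(y_1,\ldots,y_k)$ row $y_1$ of the output and delete these elements; it is known to be a bijection onto $\mathrm{qKT}^{(1)}$. $\Gamma$ (column-filling): column 1 of $\Gamma(V)$ places each entry $i$ of column 1 of $V$ in row $i$; given column $c$, the entries of column $c+1$ of $V$ are placed in decreasing order, each in the lowest row that has an entry in column $c$ weakly larger than it and an unfilled position in column $c+1$; it is known to be a bijection $\mathrm{revSSYT}\to\mathcal{A}\mathrm{SSF}$. A filling $X$ (in any of these three sets) is quasi-Yamanouchi if for every entry value $i$ of $X$, the leftmost occurrence of $i$ is in the first column of $X$ or lies in a column weakly left of some occurrence of $i+1$. $\mathrm{QrevSSYT}$, $\mathrm{QqKT}^{(1)}$, $\mathrm{QSSF}$ denote the quasi-Yamanouchi elements of $\mathrm{revSSYT}$, $\mathrm{qKT}^{(1)}$, $\mathcal{A}\mathrm{SSF}$. -}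

module Defs where

open import Data.Bool.Base using (Bool; true; false; if_then_else_)
open import Data.List.Base using (List; []; _∷_; _++_; length; map; mapMaybe;
  applyUpTo; filter; foldl; foldr)
open import Data.List.Relation.Unary.All using (All)
open import Data.List.Relation.Unary.Linked using (Linked)
open import Data.Maybe.Base using (Maybe; just; nothing)
open import Data.Nat.Base using (ℕ; zero; suc; _≤_; _<_; _≥_; _>_; _≤ᵇ_; _⊓_; _⊔_)
open import Data.Nat.ListAction using (sum)
open import Data.Nat.Properties using (_≟_; _≤?_)
open import Data.Product using (Σ; Σ-syntax; ∃-syntax; _×_; _,_; proj₁)
open import Data.Sum.Base using (_⊎_)
open import Function.Bundles using (Bijection)
open import Level using (0ℓ)
open import Relation.Binary.Bundles using (Setoid)
import Relation.Binary.Construct.On as On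
open import Relation.Binary.PropositionalEquality using (_≡_; refl; sym; trans)
open import Relation.Nullary.Decidable using (¬?)
open import Relation.Unary using (Pred; _∩_)

-- A filling is the list of its left-justified rows: row 1 first, i.e. the
-- lowest row of a skyline diagram D(a) and the top row of a partition diagram.
-- The shape a is the list of row lengths; empty rows are allowed.
-- Rows and columns are numbered from 1.

Filling : Set
Filling = List (List ℕ)

at : {A : Set} → List A → ℕ → Maybe A
at _        zero          = nothing
at []       (suc _)       = nothing
at (x ∷ _)  (suc zero)    = just x
at (_ ∷ xs) (suc (suc n)) = at xs (suc n)

row : Filling → ℕ → List ℕ
row X r with at X r
... | just R  = R
... | nothing = []

part : Filling → ℕ → ℕ
part X r = length (row X r)

entry : Filling → ℕ → ℕ → Maybe ℕ
entry X r c = at (row X r) c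

-- Equality as fillings of sets of boxes: a trailing zero of the shape adds no
-- box, so it is disregarded.

infix 4 _≈_

_≈_ : Filling → Filling → Set
X ≈ Y = ∀ r c → entry X r c ≡ entry Y r c

fillings : Setoid 0ℓ 0ℓ
fillings = record
  { Carrier       = Filling
  ; _≈_           = _≈_
  ; isEquivalence = record
    { refl  = λ _ _ → refl
    ; sym   = λ p r c → sym (p r c)
    ; trans = λ p q r c → trans (p r c) (q r c)
    }
  }

PositiveEntries : Pred Filling 0ℓ
PositiveEntries = All (All (1 ≤_))

RowsWeaklyDecrease : Pred Filling 0ℓ
RowsWeaklyDecrease = All (Linked _≥_)

DistinctInColumns : Pred Filling 0ℓ
DistinctInColumns X = ∀ {r s c v} →
  entry X r c ≡ just v → entry X s c ≡ just v → r ≡ s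

-- The entry in the first column of each nonempty row is its row index.
FirstColumnIsRowIndex : Pred Filling 0ℓ
FirstColumnIsRowIndex X = ∀ {r v} → entry X r 1 ≡ just v → v ≡ r

record RevSSYT (V : Filling) : Set where
  field
    positive        : PositiveEntries V
    partition-shape : Linked _≥_ (map length V)
    rows-decrease   : RowsWeaklyDecrease V
    columns-strict  : ∀ {r s c x y} → r < s →
      entry V r c ≡ just x → entry V s c ≡ just y → x > y

record QuasiKey (X : Filling) : Set where
  field
    positive         : PositiveEntries X
    rows-decrease    : RowsWeaklyDecrease X
    row-bound        : ∀ {r c v} → entry X r c ≡ just v → v ≤ r
    columns-distinct : DistinctInColumns X
    first-column     : ∀ {r s x y} → r < s →
      entry X r 1 ≡ just x → entry X s 1 ≡ just y → x < y
    right-neighbour  : ∀ {r s c i k} → r < s →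
      entry X s c ≡ just i → entry X r c ≡ just k → i < k →
      ∃[ j ] entry X r (suc c) ≡ just j × i < j
    longer-above     : ∀ {r s c i j} → r < s → part X r < part X s →
      entry X r c ≡ just i → entry X s (suc c) ≡ just j → i < j

record QuasiKey₁ (X : Filling) : Set where
  field
    quasi-key       : QuasiKey X
    first-row-index : FirstColumnIsRowIndex X

InversionTriple : (α β γ : ℕ) → Set
InversionTriple α β γ = (β > γ × γ ≥ α) ⊎ (γ ≥ α × α > β)

record ASSF (X : Filling) : Set where
  field
    positive         : PositiveEntries X
    rows-decrease    : RowsWeaklyDecrease X
    columns-distinct : DistinctInColumns X
    triples-A        : ∀ {r s c α β γ} → r < s → part X r ≥ part X s →
      entry X r c ≡ just γ → entry X r (suc c) ≡ just α →
      entry X s (suc c) ≡ just β → InversionTriple α β γ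
    triples-B        : ∀ {r s c α β γ} → r < s → part X s > part X r →
      entry X s c ≡ just γ → entry X s (suc c) ≡ just α →
      entry X r c ≡ just β → InversionTriple α β γ
    first-row-index  : FirstColumnIsRowIndex X

OccursInColumn : Filling → ℕ → ℕ → Set
OccursInColumn X i c = ∃[ r ] entry X r c ≡ just i

LeftmostColumn : Filling → ℕ → ℕ → Set
LeftmostColumn X i c =
  OccursInColumn X i c × (∀ c′ → OccursInColumn X i c′ → c ≤ c′)

QuasiYamanouchi : Pred Filling 0ℓ
QuasiYamanouchi X = ∀ i c → LeftmostColumn X i c →
  c ≡ 1 ⊎ ∃[ c′ ] c ≤ c′ × OccursInColumn X (suc i) c′

QRevSSYT QQuasiKey₁ QSSF : Pred Filling 0ℓ
QRevSSYT   = RevSSYT ∩ QuasiYamanouchi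
QQuasiKey₁ = QuasiKey₁ ∩ QuasiYamanouchi
QSSF       = ASSF ∩ QuasiYamanouchi

Columns : Set
Columns = List (List ℕ)

-- The entries of column c, in order of row index; decreasing for V in RevSSYT.
column : Filling → ℕ → List ℕ
column V c = mapMaybe (λ R → at R c) V

columns : Filling → Columns
columns V = applyUpTo (λ c → column V (suc c)) (foldr _⊔_ 0 (map length V))

-- Replaces row r, creating empty rows below it if necessary.
setRow : ℕ → List ℕ → Filling → Filling
setRow zero          R X       = X
setRow (suc zero)    R []      = R ∷ []
setRow (suc zero)    R (_ ∷ X) = R ∷ X
setRow (suc (suc r)) R []      = [] ∷ setRow (suc r) R []
setRow (suc (suc r)) R (S ∷ X) = S ∷ setRow (suc r) R X

smallest : List ℕ → Maybe ℕ
smallest []       = nothing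
smallest (x ∷ xs) = just (foldr _⊓_ x xs)

remove : ℕ → List ℕ → List ℕ
remove x = filter (λ z → ¬? (z ≟ x))

-- The choice of y_c from C_c, given the part (y_{c+1}, …, y_k) already chosen;
-- this part is empty when all columns to the right are.
choose : List ℕ → List ℕ → Maybe ℕ
choose []      C = smallest C
choose (y ∷ _) C = smallest (filter (y ≤?_) C)

-- One row (y_1, …, y_k), and the columns with its elements deleted.  If no y_c
-- with y_c ≥ y_{c+1} exists (which does not happen for V in RevSSYT), the part
-- already chosen is thrown away.
extractRow : Columns → List ℕ × Columns
extractRow []       = [] , []
extractRow (C ∷ Cs) with extractRow Cs
... | ys , Cs′ with choose ys C
...   | just y  = y ∷ ys , remove y C ∷ Cs′
...   | nothing = [] , C ∷ Cs′

-- The first argument bounds the number of rows extracted.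
fillRows : ℕ → Columns → Filling
fillRows zero    Cs = []
fillRows (suc n) Cs with extractRow Cs
... | []     , _   = []
... | y ∷ ys , Cs′ = setRow y (y ∷ ys) (fillRows n Cs′)

-- Every row extracted uses at least one box, so the number of boxes is a
-- sufficient bound.
ψ : Filling → Filling
ψ V = fillRows (sum (map length V)) (columns V)

-- Whether a row has an entry ≥ e in column c and nothing in column c + 1.
accepts : ℕ → ℕ → List ℕ → Bool
accepts c e R with at R c | at R (suc c)
... | just z  | nothing = e ≤ᵇ z
... | just _  | just _  = false
... | nothing | _       = false

-- Puts e in column c + 1 of the lowest row accepting it.
place : ℕ → Filling → ℕ → Filling
place c []      e = []
place c (R ∷ X) e =
  if accepts c e R then (R ++ (e ∷ [])) ∷ X else R ∷ place c X e

-- Given a filling of columns 1, …, c, fills columns c + 1, c + 2, …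
fillColumns : ℕ → Filling → Columns → Filling
fillColumns c X []       = X
fillColumns c X (C ∷ Cs) = fillColumns (suc c) (foldl (place c) X C) Cs

Γ : Filling → Filling
Γ V with columns V
... | []      = []
... | C₁ ∷ Cs = fillColumns 1 (foldr (λ i → setRow i (i ∷ [])) [] C₁) Cs

fillingsIn : Pred Filling 0ℓ → Setoid 0ℓ 0ℓ
fillingsIn P = On.setoid {B = Σ Filling P} fillings proj₁

RestrictsToBijection : (Filling → Filling) → (P Q : Pred Filling 0ℓ) → Set
RestrictsToBijection f P Q =
  Σ[ b ∈ Bijection (fillingsIn P) (fillingsIn Q) ]
    (∀ V → proj₁ (Bijection.to b V) ≈ f (proj₁ V))

-- Both maps preserve the set of entries of each column, and being quasi-Yamanouchi
-- depends on these sets only.  It therefore suffices that in each of the three classes a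
-- filling is determined by its column sets, that ψ and Γ land in the right class,
-- and that sorting the columns of a filling with weakly decreasing rows gives a
-- reverse tableau (Hall's condition passes from the rows to adjacent columns).
-- The axioms of qKT⁽¹⁾ and of ASSF are each equivalent to one local condition
-- recording that the entries were chosen greedily, by ψ row by row and by Γ column
-- by column; this gives the image of each map, and, comparing two fillings along
-- the greedy order, uniqueness.

module Submission where

open import Defs
open import Data.Bool.Base using (T; true; false)
open import Data.Empty using (⊥-elim)
open import Data.List.Base using (List; []; _∷_; _++_; length; map; applyUpTo; filter; foldr; foldl)
open import Data.List.Membership.Propositional using (_∈_; _∉_)
open import Data.List.Membership.Propositional.Properties using (∈-filter⁺; ∈-filter⁻)
open import Data.List.Properties using (filter-accept; filter-reject; filter-all; filter-none;
  filter-some; filter-notAll; map-applyUpTo)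
open import Data.List.Relation.Binary.Permutation.Propositional using (↭-sym; ↭⇒↭ₛ)
open import Data.List.Relation.Binary.Permutation.Propositional.Properties using
  (filter-↭; ↭-length; ∈-resp-↭; ↭-empty-inv)
open import Data.List.Relation.Unary.All as All using (All; []; _∷_)
import Data.List.Relation.Unary.All.Properties as All
open import Data.List.Relation.Unary.AllPairs as AllPairs using (AllPairs; []; _∷_)
open import Data.List.Relation.Unary.Any as Any using (here; there)
open import Data.List.Relation.Unary.Linked as Linked using (Linked; []; [-]; _∷_)
import Data.List.Relation.Unary.Linked.Properties as Linked
open import Data.List.Relation.Unary.Unique.Propositional using (Unique)
import Data.List.Relation.Unary.Unique.Propositional.Properties as Unique
open import Data.Maybe.Base using (Maybe; just; nothing; maybe′; fromMaybe)
open import Data.Maybe.Properties using (just-injective)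
open import Data.Nat.Base
open import Data.Nat.Induction using (<-wellFounded)
open import Data.Nat.ListAction using (sum)
open import Data.Nat.Properties
open import Data.Product using (∃-syntax; _×_; _,_; proj₁; proj₂)
open import Data.Product.Relation.Binary.Lex.Strict using (×-Lex; ×-wellFounded)
open import Data.Sum.Base using (_⊎_; inj₁; inj₂)
open import Function.Base using (_∘_; case_of_; id)
open import Induction.WellFounded using (Acc; acc)
open import Level using (0ℓ)
open import Relation.Binary.Construct.Flip.EqAndOrd using (decTotalOrder)
open import Relation.Binary.Core using (Rel)
open import Relation.Binary.Definitions using (tri<; tri≈; tri>)
open import Relation.Binary.PropositionalEquality
open import Relation.Nullary using (¬_; yes; no; contradiction)
open import Relation.Nullary.Decidable using (¬?)
open import Relation.Unary using (Pred; _∩_)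
import Data.List.Relation.Binary.Permutation.Setoid.Properties (setoid ℕ) as Permutation
open import Data.List.Sort (decTotalOrder ≤-decTotalOrder) using (sort; sort-↭; sort-↗)

-- The obstacle is that the axioms of qKT⁽¹⁾ compare rows by height, whereas ψ orders them by
-- length: the longest rows are extracted first and, among rows of equal length, those with the
-- smaller last entry. The order `_≺_` on keys records this, and in `KeyCondition` it replaces the
-- vertical order. Uniqueness then follows ψ from right to left: once the parts of the rows beyond a
-- column are known, so are the keys, and left neighbours can be compared in the order of the keys.
-- The row index is the last thing to be known, so rows are matched through their entries. For Γ the
-- greedy order is visible in the filling itself: columns from left to right, entries from large to
-- small.
--
-- Existence rests on Hall's condition, expressed by counting the entries above each threshold. It
-- supplies a candidate for every greedy choice. For ψ it also has to survive the deletion of a row,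
-- and this is where the minimality of each choice enters.

just≢nothing : {A : Set} {m : Maybe A} {x : A} → m ≡ just x → m ≢ nothing
just≢nothing refl ()

-- Partial lookup in lists, numbered from 1

module _ {A : Set} where

  at-[] : ∀ n → at {A} [] n ≡ nothing
  at-[] zero    = refl
  at-[] (suc n) = refl

  at⇒∈ : ∀ (xs : List A) n {x} → at xs n ≡ just x → x ∈ xs
  at⇒∈ (_ ∷ _)  (suc zero)    refl = here refl
  at⇒∈ (_ ∷ xs) (suc (suc n)) p    = there (at⇒∈ xs (suc n) p)

  ∈⇒at : ∀ {xs : List A} {x} → x ∈ xs → ∃[ n ] at xs (suc n) ≡ just x
  ∈⇒at (here refl) = 0 , refl
  ∈⇒at (there p) with n , q ← ∈⇒at p = suc n , q

  at-≤-length : ∀ (xs : List A) n {x} → at xs n ≡ just x → n ≤ length xs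
  at-≤-length (_ ∷ _)  (suc zero)    _ = s≤s z≤n
  at-≤-length (_ ∷ xs) (suc (suc n)) p = s≤s (at-≤-length xs (suc n) p)

  at-just : ∀ (xs : List A) n → suc n ≤ length xs → ∃[ x ] at xs (suc n) ≡ just x
  at-just (x ∷ xs) zero    _       = x , refl
  at-just (x ∷ xs) (suc n) (s≤s p) = at-just xs n p

  at-nothing : ∀ (xs : List A) n → length xs < n → at xs n ≡ nothing
  at-nothing xs n l<n with at xs n in eq
  ... | nothing = refl
  ... | just _  = contradiction (at-≤-length xs n eq) (<⇒≱ l<n)

  at-prefix : ∀ (xs : List A) {m n x} → suc m ≤ n → at xs n ≡ just x →
    ∃[ y ] at xs (suc m) ≡ just y
  at-prefix xs {m} {n} m<n p = at-just xs m (≤-trans m<n (at-≤-length xs n p))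

  All-at⁻ : ∀ {P : Pred A 0ℓ} {xs} n {x} → All P xs → at xs n ≡ just x → P x
  All-at⁻ {xs = xs} n ps p = All.lookup ps (at⇒∈ xs n p)

  All-at⁺ : ∀ {P : Pred A 0ℓ} xs → (∀ n {x} → at xs n ≡ just x → P x) → All P xs
  All-at⁺ xs f = All.tabulate λ p → let n , q = ∈⇒at p in f (suc n) q

  Linked-at⁻ : ∀ {R : Rel A 0ℓ} {xs} n {x y} → Linked R xs →
    at xs n ≡ just x → at xs (suc n) ≡ just y → R x y
  Linked-at⁻ (suc zero)    (r ∷ _)  refl refl = r
  Linked-at⁻ (suc (suc n)) (_ ∷ rs) p    q    = Linked-at⁻ (suc n) rs p q

  Linked-at⁺ : ∀ {R : Rel A 0ℓ} xs →
    (∀ n {x y} → at xs n ≡ just x → at xs (suc n) ≡ just y → R x y) → Linked R xs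
  Linked-at⁺ []           f = []
  Linked-at⁺ (x ∷ [])     f = [-]
  Linked-at⁺ (x ∷ y ∷ xs) f = f 1 refl refl ∷ Linked-at⁺ (y ∷ xs) λ
    { (suc n) p q → f (suc (suc n)) p q }

  AllPairs-at⁻ : ∀ {R : Rel A 0ℓ} {xs} m n {x y} → AllPairs R xs → m < n →
    at xs m ≡ just x → at xs n ≡ just y → R x y
  AllPairs-at⁻ (suc zero)    (suc (suc n)) (rs ∷ _) _       refl q = All-at⁻ (suc n) rs q
  AllPairs-at⁻ (suc (suc m)) (suc (suc n)) (_ ∷ rs) (s≤s l) p    q =
    AllPairs-at⁻ (suc m) (suc n) rs l p q
  AllPairs-at⁻ (suc _) (suc zero) _ (s≤s ())

-- Rows, boxes and columns of a filling

row-suc : ∀ R X r → row (R ∷ X) (suc (suc r)) ≡ row X (suc r)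
row-suc R X r with at X (suc r)
... | just _  = refl
... | nothing = refl

entry-suc : ∀ R X r c → entry (R ∷ X) (suc (suc r)) c ≡ entry X (suc r) c
entry-suc R X r c = cong (λ S → at S c) (row-suc R X r)

row-[] : ∀ r → row [] r ≡ []
row-[] r rewrite at-[] {List ℕ} r = refl

row-at : ∀ X r {R} → at X r ≡ just R → row X r ≡ R
row-at X r p rewrite p = refl

All-row⁻ : ∀ {P : Pred (List ℕ) 0ℓ} {X} → P [] → All P X → ∀ r → P (row X r)
All-row⁻ {P} {X} p[] ps r with at X r in eq
... | just _  = All-at⁻ r ps eq
... | nothing = p[]

All-row⁺ : ∀ {P : Pred (List ℕ) 0ℓ} X → (∀ r → P (row X r)) → All P X
All-row⁺ {P} X f = All-at⁺ X λ r p → subst P (row-at X r p) (f r)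

-- Indices cannot be inferred from an equation entry X r c ≡ just v, since
-- entry computes; from Cell X r c v they can.
record Cell (X : Filling) (r c v : ℕ) : Set where
  constructor cell
  field holds : entry X r c ≡ just v
open Cell

Empty : Filling → ℕ → ℕ → Set
Empty X r c = ∀ {v} → ¬ Cell X r c v

module _ {X : Filling} where

  cell? : ∀ r c → (∃[ v ] Cell X r c v) ⊎ Empty X r c
  cell? r c with entry X r c in eq
  ... | just v  = inj₁ (v , cell eq)
  ... | nothing = inj₂ λ p → just≢nothing (holds p) eq

  cell-unique : ∀ {r c v w} → Cell X r c v → Cell X r c w → v ≡ w
  cell-unique (cell p) (cell q) = just-injective (trans (sym p) q)

  cell-row≥1 : ∀ {r c v} → Cell X r c v → 1 ≤ r
  cell-row≥1 {zero}  {c} (cell p) = contradiction (at-[] c) (just≢nothing p)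
  cell-row≥1 {suc _} _ = s≤s z≤n

  cell-prefix : ∀ {r c d v} → Cell X r d v → suc c ≤ d → ∃[ w ] Cell X r (suc c) w
  cell-prefix {r} {c} (cell p) c<d with w , q ← at-prefix (row X r) {c} c<d p = w , cell q

  cell-≤-part : ∀ {r c v} → Cell X r c v → c ≤ part X r
  cell-≤-part {r} {c} (cell p) = at-≤-length (row X r) c p

  cell-within : ∀ {r} c → suc c ≤ part X r → ∃[ v ] Cell X r (suc c) v
  cell-within {r} c l with v , q ← at-just (row X r) c l = v , cell q

cells-agree : ∀ {X Y r s c} →
  (∀ {v} → Cell X r c v → Cell Y s c v) → (∀ {v} → Cell Y s c v → Cell X r c v) →
  entry X r c ≡ entry Y s c
cells-agree {X} {Y} {r} {s} {c} f g with entry X r c in p | entry Y s c in q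
... | just _  | _       = trans (sym (holds (f (cell p)))) q
... | nothing | nothing = refl
... | nothing | just _  = trans (sym p) (holds (g (cell q)))

entries-agree : ∀ {X Y} → (∀ {r c v} → Cell X r c v → Cell Y r c v) →
  (∀ {r c v} → Cell Y r c v → Cell X r c v) → X ≈ Y
entries-agree f g r c = cells-agree {r = r} {c = c} f g

cell-[] : ∀ {r c} → Empty [] r c
cell-[] {r} {c} (cell p) = just≢nothing p (trans (cong (λ S → at S c) (row-[] r)) (at-[] c))

cell-suc⁺ : ∀ {R X r c v} → Cell X (suc r) c v → Cell (R ∷ X) (suc (suc r)) c v
cell-suc⁺ {R} {X} {r} {c} (cell p) = cell (trans (entry-suc R X r c) p)

cell-suc⁻ : ∀ {R X r c v} → Cell (R ∷ X) (suc (suc r)) c v → Cell X (suc r) c v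
cell-suc⁻ {R} {X} {r} {c} (cell p) = cell (trans (sym (entry-suc R X r c)) p)

Occurs : Filling → ℕ → ℕ → Set
Occurs X v c = ∃[ r ] Cell X r c v

column-∈⁺ : ∀ {X r c v} → Cell X r c v → v ∈ column X c
column-∈⁺ {[]} p = contradiction p cell-[]
column-∈⁺ {R ∷ X} {zero} p = contradiction (cell-row≥1 p) λ ()
column-∈⁺ {R ∷ X} {suc zero} (cell p) rewrite p = here refl
column-∈⁺ {R ∷ X} {suc (suc r)} {c} p with at R c | column-∈⁺ (cell-suc⁻ p)
... | just _  | q = there q
... | nothing | q = q

column-∈⁻ : ∀ X c {v} → v ∈ column X c → Occurs X v c
column-∈⁻ (R ∷ X) c p with at R c in e | p
... | just _  | here refl = 1 , cell e
... | just _  | there q with column-∈⁻ X c q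
...   | zero  , q′ = contradiction (cell-row≥1 q′) λ ()
...   | suc r , q′ = suc (suc r) , cell-suc⁺ q′
column-∈⁻ (R ∷ X) c p | nothing | q with column-∈⁻ X c q
...   | zero  , q′ = contradiction (cell-row≥1 q′) λ ()
...   | suc r , q′ = suc (suc r) , cell-suc⁺ q′

column-AllPairs : ∀ {P : Rel ℕ 0ℓ} X c →
  (∀ {r s x y} → r < s → Cell X r c x → Cell X s c y → P x y) → AllPairs P (column X c)
column-AllPairs [] c f = []
column-AllPairs {P} (R ∷ X) c f with at R c in e
... | nothing = column-AllPairs X c λ
    { {zero}  {_}     _   p _ → contradiction (cell-row≥1 p) λ ()
    ; {suc r} {suc s} r<s p q → f (s≤s r<s) (cell-suc⁺ p) (cell-suc⁺ q) }
... | just x = All.tabulate first ∷ column-AllPairs X c λ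
    { {zero}  {_}     _   p _ → contradiction (cell-row≥1 p) λ ()
    ; {suc r} {suc s} r<s p q → f (s≤s r<s) (cell-suc⁺ p) (cell-suc⁺ q) }
  where
  first : ∀ {y} → y ∈ column X c → P x y
  first q with column-∈⁻ X c q
  ... | zero  , p = contradiction (cell-row≥1 p) λ ()
  ... | suc s , p = f {1} (s≤s (s≤s z≤n)) (cell e) (cell-suc⁺ p)

column-zero : ∀ X → column X 0 ≡ []
column-zero []      = refl
column-zero (R ∷ X) = column-zero X

column-beyond : ∀ X {c} → foldr _⊔_ 0 (map length X) < c → column X c ≡ []
column-beyond []      _ = refl
column-beyond (R ∷ X) {c} m<c
  rewrite at-nothing R c (≤-trans (s≤s (m≤m⊔n (length R) _)) m<c) =
  column-beyond X (≤-trans (s≤s (m≤n⊔m (length R) _)) m<c)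

row-applyUpTo : ∀ (f : ℕ → List ℕ) m c → (∀ {d} → m ≤ d → f d ≡ []) →
  row (applyUpTo f m) (suc c) ≡ f c
row-applyUpTo f zero    c       e = trans (row-[] (suc c)) (sym (e z≤n))
row-applyUpTo f (suc m) zero    e = refl
row-applyUpTo f (suc m) (suc c) e =
  trans (row-suc (f 0) (applyUpTo (f ∘ suc) m) c) (row-applyUpTo (f ∘ suc) m c (e ∘ s≤s))

-- `columns V` stops at the longest row; beyond it, and at index 0, both sides are empty. Later
-- arguments can thus range over all columns without a bound.
row-columns : ∀ V c → row (columns V) c ≡ column V c
row-columns V zero    = sym (column-zero V)
row-columns V (suc c) = row-applyUpTo (λ d → column V (suc d)) _ c λ m≤d →
  column-beyond V (s≤s m≤d)

column-short : ∀ {R X c} → Linked _≥_ (map length (R ∷ X)) → length R < c → column X c ≡ []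
column-short {X = []}    _       _ = refl
column-short {X = S ∷ X} {c} (p ∷ l) q
  rewrite at-nothing S c (≤-trans (s≤s p) q) = column-short {S} {X} l (≤-trans (s≤s p) q)

-- Columns are transposed rows; the shape must be a partition, since column
-- closes the gaps left by short rows.
at-column : ∀ {X} → Linked _≥_ (map length X) → ∀ r c → at (column X c) r ≡ entry X r c
at-column {[]} _ r c = trans (at-[] r) (sym (trans (cong (λ S → at S c) (row-[] r)) (at-[] c)))
at-column {R ∷ X} sh zero c = sym (at-[] c)
at-column {R ∷ X} sh (suc r) zero = trans (cong (λ C → at C (suc r)) (column-zero X)) (at-[] (suc r))
at-column {R ∷ X} sh (suc r) (suc c) with at R (suc c) in eq
at-column {R ∷ X} sh (suc zero) (suc c) | just x = sym eq
at-column {R ∷ X} sh (suc (suc r)) (suc c) | just x =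
  trans (at-column {X} (Linked.tail sh) (suc r) (suc c)) (sym (entry-suc R X r (suc c)))
at-column {R ∷ X} sh (suc r) (suc c) | nothing
  with suc c ≤? length R
... | yes l = contradiction eq (just≢nothing (proj₂ (at-just R c l)))
at-column {R ∷ X} sh (suc zero) (suc c) | nothing | no l =
  trans (cong (λ C → at C 1) (column-short {R} {X} sh (≰⇒> l))) (sym eq)
at-column {R ∷ X} sh (suc (suc r)) (suc c) | nothing | no l =
  trans (cong (λ C → at C (suc (suc r))) short) (sym (trans (entry-suc R X r (suc c))
    (trans (sym (at-column {X} (Linked.tail sh) (suc r) (suc c))) (cong (λ C → at C (suc r)) short))))
  where
  short : column X (suc c) ≡ []
  short = column-short {R} {X} sh (≰⇒> l)

-- Counting and Hall's condition

count : ℕ → List ℕ → ℕ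
count t xs = length (filter (t ≤?_) xs)

count-accept : ∀ {t x} xs → t ≤ x → count t (x ∷ xs) ≡ suc (count t xs)
count-accept xs p = cong length (filter-accept (_ ≤?_) {xs = xs} p)

count-reject : ∀ {t x} xs → x < t → count t (x ∷ xs) ≡ count t xs
count-reject xs p = cong length (filter-reject (_ ≤?_) {xs = xs} (<⇒≱ p))

count-none : ∀ {t xs} → All (_< t) xs → count t xs ≡ 0
count-none ps = cong length (filter-none (_ ≤?_) (All.map <⇒≱ ps))

count-zero : ∀ xs → count 0 xs ≡ length xs
count-zero xs = cong length (filter-all (0 ≤?_) {xs} (All.tabulate λ _ → z≤n))

count-positive : ∀ {t x xs} → x ∈ xs → t ≤ x → 0 < count t xs
count-positive x∈xs t≤x = filter-some (_ ≤?_) (Any.map (λ { refl → t≤x }) x∈xs)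

count-antitone : ∀ {s t} xs → s ≤ t → count t xs ≤ count s xs
count-antitone []       _   = z≤n
count-antitone {s} {t} (x ∷ xs) s≤t with t ≤? x | s ≤? x
... | yes p | yes q rewrite count-accept xs p | count-accept xs q = s≤s (count-antitone xs s≤t)
... | yes p | no  q = contradiction (≤-trans s≤t p) q
... | no  p | yes q rewrite count-reject xs (≰⇒> p) | count-accept xs q =
  m≤n⇒m≤1+n (count-antitone xs s≤t)
... | no  p | no  q rewrite count-reject xs (≰⇒> p) | count-reject xs (≰⇒> q) =
  count-antitone xs s≤t

count-strict : ∀ {s t x xs} → x ∈ xs → s ≤ x → x < t → count t xs < count s xs
count-strict {xs = _ ∷ xs} (here refl) s≤x x<t
  rewrite count-accept xs s≤x | count-reject xs x<t =
  s≤s (count-antitone xs (≤-trans s≤x (<⇒≤ x<t)))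
count-strict {s} {t} {xs = y ∷ xs} (there x∈xs) s≤x x<t with t ≤? y | s ≤? y
... | yes p | yes q rewrite count-accept xs p | count-accept xs q =
  s≤s (count-strict x∈xs s≤x x<t)
... | yes p | no  q = contradiction (≤-trans s≤x (≤-trans (<⇒≤ x<t) p)) q
... | no  p | yes q rewrite count-reject xs (≰⇒> p) | count-accept xs q =
  m≤n⇒m≤1+n (count-strict x∈xs s≤x x<t)
... | no  p | no  q rewrite count-reject xs (≰⇒> p) | count-reject xs (≰⇒> q) =
  count-strict x∈xs s≤x x<t

remove-drop : ∀ x xs → remove x (x ∷ xs) ≡ remove x xs
remove-drop x xs = filter-reject (λ z → ¬? (z ≟ x)) {x} {xs} (λ ¬p → ¬p refl)

remove-head : ∀ {x xs} → Unique (x ∷ xs) → remove x (x ∷ xs) ≡ xs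
remove-head {x} {xs} (x∉xs ∷ _) = trans (remove-drop x xs)
  (filter-all (λ z → ¬? (z ≟ x)) (All.map ≢-sym x∉xs))

remove-keep : ∀ {x y} xs → x ≢ y → remove y (x ∷ xs) ≡ x ∷ remove y xs
remove-keep xs p = filter-accept (λ z → ¬? (z ≟ _)) {xs = xs} p

∈-remove⁺ : ∀ {x y xs} → x ∈ xs → x ≢ y → x ∈ remove y xs
∈-remove⁺ = ∈-filter⁺ (λ z → ¬? (z ≟ _))

∈-remove⁻ : ∀ {x y xs} → x ∈ remove y xs → x ∈ xs × x ≢ y
∈-remove⁻ = ∈-filter⁻ (λ z → ¬? (z ≟ _))

-- `remove` deletes every occurrence of `y`; uniqueness makes that exactly one.
count-remove-≤ : ∀ {t y xs} → Unique xs → y ∈ xs → t ≤ y →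
  count t xs ≡ suc (count t (remove y xs))
count-remove-≤ {xs = _ ∷ xs} u (here refl) t≤y rewrite remove-head u = count-accept xs t≤y
count-remove-≤ {t} {y} {x ∷ xs} (x∉xs ∷ u) (there p) t≤y
  rewrite remove-keep {x} {y} xs (λ { refl → All.lookup x∉xs p refl }) with t ≤? x
... | yes q rewrite count-accept (remove y xs) q | count-accept xs q =
  cong suc (count-remove-≤ u p t≤y)
... | no  q rewrite count-reject (remove y xs) (≰⇒> q) | count-reject xs (≰⇒> q) =
  count-remove-≤ u p t≤y

count-remove-> : ∀ {t y} xs → y < t → count t (remove y xs) ≡ count t xs
count-remove-> [] y<t = refl
count-remove-> {t} {y} (x ∷ xs) y<t with x ≟ y
... | yes refl rewrite remove-drop x xs | count-reject xs y<t = count-remove-> xs y<t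
... | no  p rewrite remove-keep {x} {y} xs p with t ≤? x
...   | yes q rewrite count-accept (remove y xs) q | count-accept xs q =
  cong suc (count-remove-> xs y<t)
...   | no  q rewrite count-reject (remove y xs) (≰⇒> q) | count-reject xs (≰⇒> q) =
  count-remove-> xs y<t

count-⊆ : ∀ {t xs ys} → Unique xs → Unique ys → (∀ {x} → x ∈ xs → x ∈ ys) →
  count t xs ≤ count t ys
count-⊆ {xs = []} _ _ _ = z≤n
count-⊆ {t} {x ∷ xs} {ys} (x∉xs ∷ u) w f = helper (t ≤? x)
  where
  ih : count t xs ≤ count t (remove x ys)
  ih = count-⊆ u (Unique.filter⁺ (λ z → ¬? (z ≟ x)) w) λ p →
    ∈-remove⁺ (f (there p)) λ { refl → All.lookup x∉xs p refl }
  helper : _ → count t (x ∷ xs) ≤ count t ys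
  helper (yes p) rewrite count-accept xs p | count-remove-≤ w (f (here refl)) p = s≤s ih
  helper (no  p) rewrite count-reject xs (≰⇒> p) | sym (count-remove-> ys (≰⇒> p)) = ih

-- Hall's condition for matching each entry of D to a weakly larger entry of C.
Dominates : List ℕ → List ℕ → Set
Dominates C D = ∀ t → count t D ≤ count t C

-- The rows themselves are the matching: each entry of the right column has a weakly larger left
-- neighbour, so the counts can be compared one row at a time.
column-dominates : ∀ {X} → RowsWeaklyDecrease X → ∀ c →
  Dominates (column X (suc c)) (column X (suc (suc c)))
column-dominates [] c t = z≤n
column-dominates {R ∷ X} (l ∷ ls) c t
  with at R (suc c) in p | at R (suc (suc c)) in q | column-dominates ls c t
... | nothing | nothing | ih = ih
... | nothing | just y  | _  =
  contradiction p (just≢nothing (proj₂ (at-prefix R {c} {suc (suc c)} (n≤1+n _) q)))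
... | just x  | nothing | ih with t ≤? x
...   | yes t≤x rewrite count-accept (column X (suc c)) t≤x = m≤n⇒m≤1+n ih
...   | no  t≰x rewrite count-reject (column X (suc c)) (≰⇒> t≰x) = ih
column-dominates {R ∷ X} (l ∷ ls) c t | just x | just y | ih
  with t ≤? x | t ≤? y
... | yes t≤x | yes t≤y
  rewrite count-accept (column X (suc c)) t≤x | count-accept (column X (suc (suc c))) t≤y = s≤s ih
... | yes t≤x | no  t≰y
  rewrite count-accept (column X (suc c)) t≤x | count-reject (column X (suc (suc c))) (≰⇒> t≰y) =
  m≤n⇒m≤1+n ih
... | no  t≰x | yes t≤y = contradiction (≤-trans t≤y (Linked-at⁻ (suc c) l p q)) t≰x
... | no  t≰x | no  t≰y
  rewrite count-reject (column X (suc c)) (≰⇒> t≰x) | count-reject (column X (suc (suc c))) (≰⇒> t≰y) = ih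

-- Strictly decreasing lists

StrictlyDecreasing : Pred (List ℕ) 0ℓ
StrictlyDecreasing = AllPairs _>_

decreasing⇒unique : ∀ {xs} → StrictlyDecreasing xs → Unique xs
decreasing⇒unique = AllPairs.map >⇒≢

decreasing-ext : ∀ {xs ys} → StrictlyDecreasing xs → StrictlyDecreasing ys →
  (∀ {v} → v ∈ xs → v ∈ ys) → (∀ {v} → v ∈ ys → v ∈ xs) → xs ≡ ys
decreasing-ext {[]}    {[]}    _ _ f g = refl
decreasing-ext {[]}    {_ ∷ _} _ _ f g = case g (here refl) of λ ()
decreasing-ext {_ ∷ _} {[]}    _ _ f g = case f (here refl) of λ ()
decreasing-ext {x ∷ xs} {y ∷ ys} (p ∷ ps) (q ∷ qs) f g = cong₂ _∷_ x≡y
  (decreasing-ext ps qs (λ v → tail p x≡y (f (there v)) v) (λ v → tail q (sym x≡y) (g (there v)) v))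
  where
  head≤ : ∀ {a b as bs} → All (_< b) bs → a ∈ b ∷ bs → a ≤ b
  head≤ _ (here refl) = ≤-refl
  head≤ l (there a∈)  = <⇒≤ (All.lookup l a∈)
  x≡y : x ≡ y
  x≡y = ≤-antisym (head≤ {as = xs} q (f (here refl))) (head≤ {as = ys} p (g (here refl)))
  tail : ∀ {a b as bs} {v} → All (_< a) as → a ≡ b → v ∈ b ∷ bs → v ∈ as → v ∈ bs
  tail l refl (here refl) w = contradiction (All.lookup l w) (<-irrefl refl)
  tail l e    (there v)   w = v

decreasing-count : ∀ {xs} n {y} → StrictlyDecreasing xs → at xs n ≡ just y → count y xs ≡ n
decreasing-count {x ∷ xs} (suc zero) (p ∷ _) refl
  rewrite count-accept {x} xs ≤-refl | count-none p = refl
decreasing-count {x ∷ xs} (suc (suc n)) (p ∷ ps) q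
  rewrite count-accept xs (<⇒≤ (All-at⁻ (suc n) p q)) = cong suc (decreasing-count (suc n) ps q)

decreasing-at : ∀ {xs} n {t} → StrictlyDecreasing xs → n < count t xs →
  ∃[ x ] at xs (suc n) ≡ just x × t ≤ x
decreasing-at {x ∷ xs} n {t} (p ∷ ps) q with t ≤? x
... | no  t≰x = contradiction q
  (subst (λ m → ¬ n < m) (sym (trans (count-reject xs (≰⇒> t≰x))
    (count-none (All.map (λ l → <-trans l (≰⇒> t≰x)) p)))) λ ())
decreasing-at zero          _        _ | yes t≤x = _ , refl , t≤x
decreasing-at {x ∷ xs} (suc n) (_ ∷ ps) q | yes t≤x
  rewrite count-accept xs t≤x = decreasing-at n ps (s≤s⁻¹ q)

-- The entry of `D` in position `suc n` has `suc n` entries of `D` weakly above it, hence at least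
-- as many of `C`. For sorted columns Hall's condition thus becomes the weak decrease of rows.
dominates-at : ∀ {C D} n {y} → StrictlyDecreasing C → StrictlyDecreasing D → Dominates C D →
  at D (suc n) ≡ just y → ∃[ x ] at C (suc n) ≡ just x × y ≤ x
dominates-at n p q d e =
  decreasing-at n p (≤-trans (≤-reflexive (sym (decreasing-count (suc n) q e))) (d _))

-- `sort` is taken for the reversed order on ℕ, so it sorts downwards; distinctness makes the
-- decrease strict.
sort-decreasing : ∀ {xs} → Unique xs → StrictlyDecreasing (sort xs)
sort-decreasing {xs} u = AllPairs.map (λ (p , q) → ≤∧≢⇒< p (≢-sym q))
  (AllPairs.zip (Linked.Linked⇒AllPairs (λ p q → ≤-trans q p) (sort-↗ xs) ,
                 Permutation.Unique-resp-↭ (↭⇒↭ₛ (↭-sym (sort-↭ xs))) u))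

count-sort : ∀ t xs → count t (sort xs) ≡ count t xs
count-sort t xs = ↭-length (filter-↭ (t ≤?_) (sort-↭ xs))

-- Column sets

infix 4 _⊑_

_⊑_ : Filling → Filling → Set
X ⊑ Y = ∀ {v c} → Occurs X v c → Occurs Y v c

SameColumns : Filling → Filling → Set
SameColumns X Y = X ⊑ Y × Y ⊑ X

≈⇒⊑ : ∀ {X Y} → X ≈ Y → X ⊑ Y
≈⇒⊑ e {c = c} (r , cell p) = r , cell (trans (sym (e r c)) p)

SameColumns-sym : ∀ {X Y} → SameColumns X Y → SameColumns Y X
SameColumns-sym (f , g) = g , f

SameColumns-trans : ∀ {X Y Z} → SameColumns X Y → SameColumns Y Z → SameColumns X Z
SameColumns-trans (f , g) (f′ , g′) = (λ o → f′ (f o)) , (λ o → g (g′ o))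

≈⇒SameColumns : ∀ {X Y} → X ≈ Y → SameColumns X Y
≈⇒SameColumns {X} {Y} e = ≈⇒⊑ {X} {Y} e , ≈⇒⊑ {Y} {X} λ r c → sym (e r c)

QuasiYamanouchi-resp : ∀ {X Y} → SameColumns X Y → QuasiYamanouchi X → QuasiYamanouchi Y
QuasiYamanouchi-resp {X} {Y} (f , g) q i c (o , least)
  with q i c (transport c g o , λ c′ o′ → least c′ (transport c′ f o′))
  where
  transport : ∀ {V W i} c → V ⊑ W → OccursInColumn V i c → OccursInColumn W i c
  transport c h (r , p) = let s , cell p′ = h (r , cell {c = c} p) in s , p′
... | inj₁ e = inj₁ e
... | inj₂ (c′ , l , r , p) = let s , cell p′ = f (r , cell {c = c′} p) in inj₂ (c′ , l , s , p′)

module _ {V : Filling} (v : RevSSYT V) where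
  open RevSSYT v

  column-decreasing : ∀ c → StrictlyDecreasing (column V c)
  column-decreasing c = column-AllPairs V c λ r<s (cell p) (cell q) → columns-strict {c = c} r<s p q

-- In a partition shape the position of an entry within its column list is its row, and a strictly
-- decreasing list is determined by its set.
RevSSYT-determined : ∀ {V W} → RevSSYT V → RevSSYT W → SameColumns V W → V ≈ W
RevSSYT-determined {V} {W} v w (f , g) r c =
  trans (sym (at-column (RevSSYT.partition-shape v) r c))
    (trans (cong (λ C → at C r) same-column) (at-column (RevSSYT.partition-shape w) r c))
  where
  same-column : column V c ≡ column W c
  same-column = decreasing-ext (column-decreasing v c) (column-decreasing w c)
    (λ p → column-∈⁺ (proj₂ (f (column-∈⁻ V c p)))) (λ p → column-∈⁺ (proj₂ (g (column-∈⁻ W c p))))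

length-column : ∀ X c → length (column X (suc (suc c))) ≤ length (column X (suc c))
length-column [] c = z≤n
length-column (R ∷ X) c with at R (suc c) in p | at R (suc (suc c)) in q
... | nothing | nothing = length-column X c
... | nothing | just _  =
  contradiction p (just≢nothing (proj₂ (at-prefix R {c} {suc (suc c)} (n≤1+n _) q)))
... | just _  | nothing = m≤n⇒m≤1+n (length-column X c)
... | just _  | just _  = s≤s (length-column X c)

-- Sorting the columns into a reverse tableau

DistinctCells : Pred Filling 0ℓ
DistinctCells X = ∀ {r s c v} → Cell X r c v → Cell X s c v → r ≡ s

column-unique : ∀ {X} → DistinctCells X → ∀ c → Unique (column X c)
column-unique {X} d c = column-AllPairs X c λ { r<s p q refl → <⇒≢ r<s (d p q) }

sort-empty : ∀ {xs} → xs ≡ [] → sort xs ≡ []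
sort-empty refl = ↭-empty-inv (sort-↭ [])

module Straighten {X : Filling} (positive : PositiveEntries X)
  (rows-decrease : RowsWeaklyDecrease X) (columns-distinct : DistinctCells X) where

  sorted-columns : Filling
  sorted-columns = applyUpTo (λ c → sort (column X (suc c))) (foldr _⊔_ 0 (map length X))

  row-sorted-columns : ∀ c → row sorted-columns c ≡ sort (column X c)
  row-sorted-columns zero    = sym (sort-empty (column-zero X))
  row-sorted-columns (suc c) = row-applyUpTo (λ d → sort (column X (suc d))) _ c λ m≤d →
    sort-empty (column-beyond X (s≤s m≤d))

  sorted-dominates : ∀ c → Dominates (sort (column X (suc c))) (sort (column X (suc (suc c))))
  sorted-dominates c t rewrite count-sort t (column X (suc c)) | count-sort t (column X (suc (suc c))) =
    column-dominates rows-decrease c t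

  -- `columns` serves as transposition: `sorted-columns` has the sorted columns of `X` as its rows,
  -- and they have to become columns again.
  straightened : Filling
  straightened = columns sorted-columns

  entry-straightened : ∀ r c → entry straightened r c ≡ at (sort (column X c)) r
  entry-straightened r c = trans (cong (λ R → at R c) (row-columns sorted-columns r))
    (trans (at-column shape c r) (cong (λ C → at C r) (row-sorted-columns c)))
    where
    shape : Linked _≥_ (map length sorted-columns)
    -- At threshold 0 every entry counts, so domination compares the lengths of adjacent columns.
    shape = subst (Linked _≥_) (sym (map-applyUpTo (λ c → sort (column X (suc c))) length _))
      (Linked.applyUpTo⁺₂ (λ c → length (sort (column X (suc c)))) _ λ c →
        subst₂ _≤_ (count-zero (sort (column X (suc (suc c))))) (count-zero (sort (column X (suc c))))
          (sorted-dominates c 0))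

  straightened-same : SameColumns straightened X
  straightened-same =
    (λ { {v} {c} (r , cell p) → column-∈⁻ X c (∈-resp-↭ (sort-↭ (column X c))
           (at⇒∈ (sort (column X c)) r (trans (sym (entry-straightened r c)) p))) }) ,
    (λ { {v} {c} (r , p) → let n , q = ∈⇒at (∈-resp-↭ (↭-sym (sort-↭ (column X c))) (column-∈⁺ p))
         in suc n , cell (trans (entry-straightened (suc n) c) q) })

  straightened-RevSSYT : RevSSYT straightened
  straightened-RevSSYT = record
    { positive = All-row⁺ straightened λ r → All-at⁺ (row straightened r) λ c p →
        let s , cell q = proj₁ straightened-same (r , cell {c = c} p)
        in All-at⁻ c (All-row⁻ [] positive s) q
    ; partition-shape = subst (Linked _≥_)
        (sym (map-applyUpTo (λ r → column sorted-columns (suc r)) length _))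
        (Linked.applyUpTo⁺₂ (λ r → length (column sorted-columns (suc r))) _
          (length-column sorted-columns))
    ; rows-decrease = All-row⁺ straightened λ r → Linked-at⁺ (row straightened r) (decrease r)
    ; columns-strict = λ {r} {s} {c} r<s p q →
        AllPairs-at⁻ r s (sort-decreasing (column-unique columns-distinct c)) r<s
        (trans (sym (entry-straightened r c)) p) (trans (sym (entry-straightened s c)) q)
    }
    where
    decrease : ∀ r c {x y} → entry straightened r c ≡ just x → entry straightened r (suc c) ≡ just y → x ≥ y
    decrease zero    c       {x} p _ = contradiction (at-[] c) (just≢nothing p)
    decrease (suc r) zero    p _ = contradiction p λ ()
    decrease (suc r) (suc c) p q
      with x , p′ , y≤x ← dominates-at r (sort-decreasing (column-unique columns-distinct (suc c)))
             (sort-decreasing (column-unique columns-distinct (suc (suc c)))) (sorted-dominates c)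
             (trans (sym (entry-straightened (suc r) (suc (suc c)))) q)
      rewrite just-injective (trans (sym p) (trans (entry-straightened (suc r) (suc c)) p′)) = y≤x

-- Bijectivity from column sets

record DeterminedByColumns (P : Pred Filling 0ℓ) : Set where
  field
    positive         : ∀ {X} → P X → PositiveEntries X
    rows-decrease    : ∀ {X} → P X → RowsWeaklyDecrease X
    columns-distinct : ∀ {X} → P X → DistinctCells X
    determined       : ∀ {X Y} → P X → P Y → SameColumns X Y → X ≈ Y

-- No inverse map is constructed. The preimage of `X` is its straightening, whose image has the
-- column sets of `X` and is therefore `X` by `determined`.
restricts-to-bijection : ∀ {f P} → DeterminedByColumns P →
  (∀ {V} → RevSSYT V → P (f V) × SameColumns (f V) V) →
  RestrictsToBijection f QRevSSYT (P ∩ QuasiYamanouchi)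
restricts-to-bijection {f} {P} det image = record
  { to        = λ { (V , v , q) → f V , proj₁ (image v) , QuasiYamanouchi-resp (SameColumns-sym (same v)) q }
  -- `f` acts on the raw list of rows, while `_≈_` disregards trailing empty rows; that `f` respects
  -- `_≈_` is again a consequence of uniqueness.
  ; cong      = λ { {V , v , _} {W , w , _} e → determined (proj₁ (image v)) (proj₁ (image w))
      (SameColumns-trans (same v) (SameColumns-trans (≈⇒SameColumns e) (SameColumns-sym (same w)))) }
  ; bijective =
      (λ { {V , v , _} {W , w , _} e → RevSSYT-determined v w
        (SameColumns-trans (SameColumns-sym (same v)) (SameColumns-trans (≈⇒SameColumns e) (same w))) }) ,
      λ { (X , p , q) →
        let open Straighten (positive p) (rows-decrease p) (columns-distinct p) in
        (straightened , straightened-RevSSYT , QuasiYamanouchi-resp (SameColumns-sym straightened-same) q) ,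
        λ { {W , w , _} e → determined (proj₁ (image w)) p
          (SameColumns-trans (same w) (SameColumns-trans (≈⇒SameColumns e) straightened-same)) } }
  } , λ _ _ _ → refl
  where
  open DeterminedByColumns det
  same : ∀ {V} → RevSSYT V → SameColumns (f V) V
  same v = proj₂ (image v)

-- Semi-skyline fillings

-- The axioms common to `ASSF` and `QuasiKey₁`, phrased with `Cell` so that indices are inferred.
record Tableau (X : Filling) : Set where
  field
    positive         : ∀ {r c v} → Cell X r c v → 1 ≤ v
    rows-decrease    : ∀ {r c x y} → Cell X r c x → Cell X r (suc c) y → y ≤ x
    columns-distinct : DistinctCells X
    first-row-index  : ∀ {r v} → Cell X r 1 v → v ≡ r

cells-positive : ∀ {X} → PositiveEntries X → ∀ {r c v} → Cell X r c v → 1 ≤ v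
cells-positive p {r} {c} (cell q) = All-at⁻ c (All-row⁻ [] p r) q

cells-decrease : ∀ {X} → RowsWeaklyDecrease X →
  ∀ {r c x y} → Cell X r c x → Cell X r (suc c) y → y ≤ x
cells-decrease l {r} {c} (cell p) (cell q) = Linked-at⁻ c (All-row⁻ [] l r) p q

tableau-[] : Tableau []
tableau-[] = record
  { positive         = λ p → contradiction p cell-[]
  ; rows-decrease    = λ p → contradiction p cell-[]
  ; columns-distinct = λ p → contradiction p cell-[]
  ; first-row-index  = λ p → contradiction p cell-[]
  }

module TableauProperties {X : Filling} (t : Tableau X) where
  open Tableau t

  positive-entries : PositiveEntries X
  positive-entries = All-row⁺ X λ r → All-at⁺ (row X r) λ c p → positive {r} {c} (cell p)

  rows-weakly-decrease : RowsWeaklyDecrease X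
  rows-weakly-decrease = All-row⁺ X λ r → Linked-at⁺ (row X r) λ c p q →
    rows-decrease {r} {c} (cell p) (cell q)

  cell-≤-row : ∀ {r c v} → Cell X r c v → v ≤ r
  cell-≤-row {c = zero} (cell p) = contradiction p λ ()
  cell-≤-row {c = suc zero} p = ≤-reflexive (first-row-index p)
  cell-≤-row {c = suc (suc c)} p =
    let _ , q = cell-prefix {c = c} p (n≤1+n _) in ≤-trans (rows-decrease q p) (cell-≤-row q)

cell-row-≤-length : ∀ {X r c v} → Cell X r c v → r ≤ length X
cell-row-≤-length {X} {r} {c} (cell p) with at X r in eq
... | just _  = at-≤-length X r eq
... | nothing = contradiction (at-[] c) (just≢nothing p)

-- The common form of both kinds of inversion triples: whatever lies below and
-- to the left of an entry is smaller, or has a right neighbour that is larger.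
SkylineCondition : Pred Filling 0ℓ
SkylineCondition X = ∀ {r s c x y} → r < s → Cell X r c x → Cell X s (suc c) y →
  x < y ⊎ ∃[ z ] Cell X r (suc c) z × y < z

ASSF⇒Tableau : ∀ {X} → ASSF X → Tableau X
ASSF⇒Tableau a = record
  { positive         = cells-positive (ASSF.positive a)
  ; rows-decrease    = cells-decrease (ASSF.rows-decrease a)
  ; columns-distinct = λ { {c = c} (cell p) (cell q) → ASSF.columns-distinct a {c = c} p q }
  ; first-row-index  = λ { (cell p) → ASSF.first-row-index a p }
  }

ASSF⇒SkylineCondition : ∀ {X} → ASSF X → SkylineCondition X
ASSF⇒SkylineCondition {X} a = condition
  where
  open ASSF a using (triples-A; triples-B)
  open Tableau (ASSF⇒Tableau a)

  -- Induction on the column, starting from the row indices in column 1. The type B triple with its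
  -- corner in the previous column leaves two cases: `β > γ` contradicts the induction hypothesis,
  -- and `α > β` gives the claim because `x ≤ β`.
  columns-increase : ∀ c {r s x y} → r < s → part X r < part X s →
    Cell X r (suc c) x → Cell X s (suc c) y → x < y
  columns-increase zero r<s _ p q
    rewrite first-row-index p | first-row-index q = r<s
  columns-increase (suc c) r<s l p q
    with _ , p′ ← cell-prefix {c = c} p (n≤1+n _) | _ , q′ ← cell-prefix {c = c} q (n≤1+n _)
    with columns-increase c r<s l p′ q′ | triples-B {c = suc c} r<s l (holds q′) (holds q) (holds p′)
  ... | lt | inj₁ (gt , _) = contradiction lt (<⇒≯ gt)
  ... | _  | inj₂ (_ , gt) = ≤-<-trans (rows-decrease p′ p) gt

  condition : SkylineCondition X
  condition {c = zero} _ (cell p) _ = contradiction p λ ()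
  condition {r} {s} {suc c} r<s p q with part X s ≤? part X r
  ... | yes l with _ , p′ ← cell-within {X} {r} (suc c) (≤-trans (cell-≤-part q) l)
      with triples-A {c = suc c} r<s l (holds p) (holds p′) (holds q)
  ...   | inj₁ (gt , _) = inj₁ gt
  ...   | inj₂ (_ , gt) = inj₂ (_ , p′ , gt)
  condition {r} {s} {suc c} r<s p q | no l
    with _ , q′ ← cell-prefix {c = c} q (n≤1+n _)
    with triples-B {c = suc c} r<s (≰⇒> l) (holds q′) (holds q) (holds p)
  ... | inj₁ (gt , _) = contradiction (columns-increase c r<s (≰⇒> l) p q′) (<⇒≯ gt)
  ... | inj₂ (_ , gt) = inj₁ gt

SkylineCondition⇒ASSF : ∀ {X} → Tableau X → SkylineCondition X → ASSF X
SkylineCondition⇒ASSF {X} t local = record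
  { positive         = positive-entries
  ; rows-decrease    = rows-weakly-decrease
  ; columns-distinct = λ {r} {s} {c} p q → columns-distinct (cell {X} {r} {c} p) (cell q)
  ; triples-A        = λ {r} {s} {c} r<s _ p p′ q → triple-A r<s (cell {X} {r} {c} p) (cell p′) (cell q)
  ; triples-B        = λ {r} {s} {c} r<s l q q′ p → triple-B r<s l (cell {X} {s} {c} q) (cell q′) (cell p)
  ; first-row-index  = λ p → first-row-index (cell p)
  }
  where
  open Tableau t
  open TableauProperties t

  triple-A : ∀ {r s c α β γ} → r < s → Cell X r c γ → Cell X r (suc c) α → Cell X s (suc c) β →
    InversionTriple α β γ
  triple-A r<s p p′ q with local r<s p q
  ... | inj₁ lt = inj₁ (lt , rows-decrease p p′)
  ... | inj₂ (_ , p″ , lt) rewrite cell-unique p″ p′ = inj₂ (rows-decrease p p′ , lt)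

  -- A smaller entry above a larger one reproduces itself in the next column: the longer row `s`
  -- continues there, and the condition forces row `r` to continue with something larger. So row `r`
  -- would never end; `n` bounds the columns still available.
  longer-stays-below : ∀ n {r s c x y} → r < s → part X r < part X s → part X r < c + n →
    Cell X r c x → Cell X s c y → ¬ y < x
  longer-stays-below zero {c = c} _ _ l p _ _ rewrite +-identityʳ c = <⇒≱ l (cell-≤-part p)
  longer-stays-below (suc n) {r} {c = c} r<s l f p q y<x
    with _ , q′ ← cell-within c (≤-trans (s≤s (cell-≤-part p)) l)
    with local r<s p q′
  ... | inj₁ lt = <⇒≱ y<x (≤-trans (<⇒≤ lt) (rows-decrease q q′))
  ... | inj₂ (_ , p′ , lt) =
    longer-stays-below n r<s l (subst (part X r <_) (+-suc c n) f) p′ q′ lt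

  triple-B : ∀ {r s c α β γ} → r < s → part X s > part X r →
    Cell X s c γ → Cell X s (suc c) α → Cell X r c β → InversionTriple α β γ
  triple-B {r} {c = c} r<s l q q′ p with local r<s p q′
  ... | inj₁ lt = inj₂ (rows-decrease q q′ , lt)
  ... | inj₂ (_ , p′ , lt) =
    contradiction lt (longer-stays-below (suc (part X r)) r<s l (m≤n+m (suc (part X r)) (suc c)) p′ q′)

module _ {X Y : Filling} (tX : Tableau X) (tY : Tableau Y) where

  first-columns-agree : X ⊑ Y → ∀ {r v} → Cell X r 1 v → Cell Y r 1 v
  first-columns-agree f p with s , q ← f (_ , p)
    with refl ← Tableau.first-row-index tX p | refl ← Tableau.first-row-index tY q = q

  -- One step down the entries of column c + 2, all larger ones being known to agree.
  skyline-step : SkylineCondition X → SkylineCondition Y → X ⊑ Y → ∀ {c v} →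
    (∀ {r x} → Cell X r (suc c) x → Cell Y r (suc c) x) →
    (∀ {r x} → Cell Y r (suc c) x → Cell X r (suc c) x) →
    (∀ {r x} → v < x → Cell X r (suc (suc c)) x → Cell Y r (suc (suc c)) x) →
    (∀ {r x} → v < x → Cell Y r (suc (suc c)) x → Cell X r (suc (suc c)) x) →
    ∀ {r} → Cell X r (suc (suc c)) v → Cell Y r (suc (suc c)) v
  skyline-step localX localY f {c} X→Y Y→X X→Y′ Y→X′ {r} p with s , q ← f (_ , p)
    with _ , p₀ ← cell-prefix {c = c} p (n≤1+n _) | _ , q₀ ← cell-prefix {c = c} q (n≤1+n _)
    with <-cmp r s
  ... | tri≈ _ refl _ = q
  -- The lower row `r` of `Y` has the same left neighbour as in `X`, so `v` would fit there. By
  -- greediness that box holds a larger entry, and on larger entries the two fillings already agree.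
  ... | tri< r<s _ _ with localY r<s (X→Y p₀) q
  ...   | inj₁ lt = contradiction (Tableau.rows-decrease tX p₀ p) (<⇒≱ lt)
  ...   | inj₂ (_ , q′ , lt) = contradiction (cell-unique p (Y→X′ lt q′)) (<⇒≢ lt)
  skyline-step localX localY f {c} X→Y Y→X X→Y′ Y→X′ {r} p | tri> _ _ s<r
    with localX s<r (Y→X q₀) p
  ...   | inj₁ lt = contradiction (Tableau.rows-decrease tY q₀ q) (<⇒≱ lt)
  ...   | inj₂ (_ , p′ , lt) = contradiction (cell-unique q (X→Y′ lt p′)) (<⇒≢ lt)

-- Induction in the order of Γ: columns from the left, and within a column from large values to
-- small. An entry is at most its row index, hence at most `length X`; above this value no entry
-- occurs in either filling, and the descent starts there.
skyline-determined : ∀ {X Y} → Tableau X → Tableau Y → SkylineCondition X → SkylineCondition Y →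
  SameColumns X Y → X ≈ Y
skyline-determined {X} {Y} tX tY localX localY (f , g) =
  entries-agree (proj₁ (agree _)) (proj₂ (agree _))
  where
  Agree : ℕ → Set
  Agree c = (∀ {r x} → Cell X r c x → Cell Y r c x) × (∀ {r x} → Cell Y r c x → Cell X r c x)

  step : ∀ c → Agree (suc c) → ∀ n v → length X < v + n →
    (∀ {r} → Cell X r (suc (suc c)) v → Cell Y r (suc (suc c)) v) ×
    (∀ {r} → Cell Y r (suc (suc c)) v → Cell X r (suc (suc c)) v)
  step c ag zero v l rewrite +-identityʳ v = (λ p → ⊥-elim (large p)) ,
      λ q → ⊥-elim (large (proj₂ (g (_ , q))))
    where
    large : ∀ {r d} → ¬ Cell X r d v
    large p = <⇒≱ l (≤-trans (TableauProperties.cell-≤-row tX p) (cell-row-≤-length p))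
  step c (X→Y , Y→X) (suc n) v l =
    skyline-step tX tY localX localY f X→Y Y→X larger larger′ ,
    skyline-step tY tX localY localX g Y→X X→Y larger′ larger
    where
    bound : ∀ {x} → v < x → length X < x + n
    bound lt = ≤-trans l (≤-trans (≤-reflexive (+-suc v n)) (+-monoˡ-≤ n lt))
    larger : ∀ {r x} → v < x → Cell X r (suc (suc c)) x → Cell Y r (suc (suc c)) x
    larger lt = proj₁ (step c (X→Y , Y→X) n _ (bound lt))
    larger′ : ∀ {r x} → v < x → Cell Y r (suc (suc c)) x → Cell X r (suc (suc c)) x
    larger′ lt = proj₂ (step c (X→Y , Y→X) n _ (bound lt))

  agree : ∀ c → Agree c
  agree zero          = (λ { (cell p) → contradiction p λ () }) , λ { (cell p) → contradiction p λ () }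
  agree (suc zero)    = first-columns-agree tX tY f , first-columns-agree tY tX g
  agree (suc (suc c)) = (λ {_} {x} → proj₁ (step c (agree (suc c)) _ x (m≤n+m _ _))) ,
    λ {_} {x} → proj₂ (step c (agree (suc c)) _ x (m≤n+m _ _))

ASSF-determined : DeterminedByColumns ASSF
ASSF-determined = record
  { positive         = ASSF.positive
  ; rows-decrease    = ASSF.rows-decrease
  ; columns-distinct = λ a → Tableau.columns-distinct (ASSF⇒Tableau a)
  ; determined       = λ a b → skyline-determined (ASSF⇒Tableau a) (ASSF⇒Tableau b)
      (ASSF⇒SkylineCondition a) (ASSF⇒SkylineCondition b)
  }

-- Quasi-key tableaux

Key : Set
Key = ℕ × ℕ

-- The length and the last entry of a row determine when ψ extracts it.
row-key : List ℕ → Key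
row-key R = length R , fromMaybe 0 (at R (length R))

key : Filling → ℕ → Key
key X r = row-key (row X r)

infix 4 _≺_

-- The order of extraction: a smaller key belongs to a row that ψ extracts earlier.
_≺_ : Key → Key → Set
(p , x) ≺ (q , y) = q < p ⊎ (p ≡ q × x < y)

≺-irrefl : ∀ k → ¬ k ≺ k
≺-irrefl k (inj₁ l)       = <-irrefl refl l
≺-irrefl k (inj₂ (_ , l)) = <-irrefl refl l

≺⇒≥ : ∀ {k l} → k ≺ l → proj₁ l ≤ proj₁ k
≺⇒≥ (inj₁ l)       = <⇒≤ l
≺⇒≥ (inj₂ (e , _)) = ≤-reflexive (sym e)

-- A row with a box is nonempty, so the default 0 in `row-key` is not reached.
last-cell : ∀ {X r c v} → Cell X r c v → Cell X r (part X r) (proj₂ (key X r))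
last-cell {X} {r} {zero} (cell p) = contradiction p λ ()
last-cell {X} {r} {suc c} p with part X r | cell-≤-part p | cell-within {X} {r}
... | suc n | _ | f with _ , q ← f n ≤-refl =
  cell (trans (holds q) (cong (just ∘ fromMaybe 0) (sym (holds q))))

-- Two rows with equal keys would have the same last entry in the same column.
key-total : ∀ {X r s c v w} → DistinctCells X → Cell X r c v → Cell X s c w →
  r ≡ s ⊎ (key X r ≺ key X s) ⊎ (key X s ≺ key X r)
key-total {X} {r} {s} d p q with <-cmp (part X r) (part X s)
... | tri< l _ _ = inj₂ (inj₂ (inj₁ l))
... | tri> _ _ l = inj₂ (inj₁ (inj₁ l))
... | tri≈ _ e _ with <-cmp (proj₂ (key X r)) (proj₂ (key X s))
...   | tri< l _ _ = inj₂ (inj₁ (inj₂ (e , l)))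
...   | tri> _ _ l = inj₂ (inj₂ (inj₂ (sym e , l)))
...   | tri≈ _ f _ = inj₁ (d (last-cell p) (subst₂ (Cell X s) (sym e) (sym f) (last-cell q)))

-- Of the entries left over when a row is extracted, none lies between two
-- neighbours of this row, since the left one was chosen smallest; conditions (3)
-- and (4) of a quasi-key tableau together are equivalent to this.
KeyCondition : Pred Filling 0ℓ
KeyCondition X = ∀ {r s c x y} → key X r ≺ key X s → Cell X r c x → Cell X s c y →
  x < y ⊎ ∃[ z ] Cell X r (suc c) z × y < z

QuasiKey₁⇒Tableau : ∀ {X} → QuasiKey₁ X → Tableau X
QuasiKey₁⇒Tableau k = record
  { positive         = cells-positive positive
  ; rows-decrease    = cells-decrease rows-decrease
  ; columns-distinct = λ { {c = c} (cell p) (cell q) → columns-distinct {c = c} p q }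
  ; first-row-index  = λ { (cell p) → QuasiKey₁.first-row-index k p }
  }
  where open QuasiKey (QuasiKey₁.quasi-key k)

QuasiKey₁⇒KeyCondition : ∀ {X} → QuasiKey₁ X → KeyCondition X
QuasiKey₁⇒KeyCondition {X} k {r} {s} {c} prec p q with <-cmp r s
... | tri≈ _ refl _ = contradiction prec (≺-irrefl _)
... | tri< r<s _ _ with <-cmp (Cell-value p) (Cell-value q)
  where
  Cell-value : ∀ {r c v} → Cell X r c v → ℕ
  Cell-value {v = v} _ = v
...   | tri< l _ _ = inj₁ l
...   | tri≈ _ refl _ = contradiction (Tableau.columns-distinct (QuasiKey₁⇒Tableau k) p q) (<⇒≢ r<s)
...   | tri> _ _ l with z , e , lt ← QuasiKey.right-neighbour (QuasiKey₁.quasi-key k) {c = c}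
                           r<s (holds q) (holds p) l =
  inj₂ (z , cell e , lt)
QuasiKey₁⇒KeyCondition {X} k {r} {s} {c} prec p q | tri> _ _ s<r with prec
... | inj₁ l with z , p′ ← cell-within {X} {r} c (≤-trans (s≤s (cell-≤-part q)) l) =
  inj₂ (z , p′ , QuasiKey.longer-above (QuasiKey₁.quasi-key k) {c = c} s<r l (holds q) (holds p′))
-- Here the rows are equally long and the higher row `r` has the smaller last entry. Condition (3)
-- in the last column would give row `s` a box beyond its end.
... | inj₂ (e , l)
  with _ , f , _ ← QuasiKey.right-neighbour (QuasiKey₁.quasi-key k) {c = part X r} s<r (holds (last-cell p))
    (trans (cong (entry X s) e) (holds (last-cell q))) l =
  contradiction (cell-≤-part {X} {s} {suc (part X r)} (cell f)) (<⇒≱ (s≤s (≤-reflexive (sym e))))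

KeyCondition⇒QuasiKey₁ : ∀ {X} → Tableau X → KeyCondition X → QuasiKey₁ X
KeyCondition⇒QuasiKey₁ {X} t local = record
  { quasi-key = record
    { positive         = positive-entries
    ; rows-decrease    = rows-weakly-decrease
    ; row-bound        = λ {r} {c} p → cell-≤-row {r} {c} (cell p)
    ; columns-distinct = λ {r} {s} {c} p q → columns-distinct (cell {X} {r} {c} p) (cell q)
    ; first-column     = λ r<s p q →
        subst₂ _<_ (sym (first-row-index (cell p))) (sym (first-row-index (cell q))) r<s
    ; right-neighbour  = λ {r} {s} {c} r<s q p l →
        let z , p′ , lt = right r<s (cell {X} {s} {c} q) (cell p) l in z , holds p′ , lt
    ; longer-above     = λ {r} {s} {c} r<s l p q → longer r<s l (cell {X} {r} {c} p) (cell q)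
    }
  ; first-row-index = λ p → first-row-index (cell p)
  }
  where
  open Tableau t
  open TableauProperties t

  -- `KeyCondition` offers this or a smaller entry in the higher row `s`. The latter is excluded by
  -- induction on the column: column 1 holds row indices, and `below` one column to the left carries
  -- the inequality over. Condition (4) is the special case of a strictly longer `s`.
  below : ∀ c {r s x} → r < s → key X s ≺ key X r → Cell X r (suc c) x →
    ∃[ z ] Cell X s (suc (suc c)) z × x < z
  below c {r} {s} r<s prec p
    with _ , q ← cell-within {X} {s} c (≤-trans (cell-≤-part p) (≺⇒≥ prec))
    with local prec q p
  ... | inj₂ right = right
  ... | inj₁ lt    = contradiction lt (<⇒≯ (increase c p q))
    where
    increase : ∀ c {x y} → Cell X r (suc c) x → Cell X s (suc c) y → x < y
    increase zero p q rewrite first-row-index p | first-row-index q = r<s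
    increase (suc c) p q with _ , p₀ ← cell-prefix {c = c} p (n≤1+n _)
      with _ , q₀ , lt₀ ← below c r<s prec p₀ rewrite cell-unique q q₀ =
      ≤-<-trans (rows-decrease p₀ p) lt₀

  right : ∀ {r s c x y} → r < s → Cell X s c y → Cell X r c x → y < x →
    ∃[ z ] Cell X r (suc c) z × y < z
  right {c = zero} r<s (cell q) p lt = contradiction q λ ()
  right {c = suc c} r<s q p lt with key-total columns-distinct p q
  ... | inj₁ refl = contradiction r<s (<-irrefl refl)
  ... | inj₂ (inj₂ prec) with _ , q′ , lt′ ← below c r<s prec p =
    contradiction (rows-decrease q q′) (<⇒≱ (<-trans lt lt′))
  ... | inj₂ (inj₁ prec) with local prec p q
  ...   | inj₁ gt = contradiction lt (<⇒≯ gt)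
  ...   | inj₂ z  = z

  longer : ∀ {r s c x y} → r < s → part X r < part X s → Cell X r c x → Cell X s (suc c) y → x < y
  longer {c = zero}  r<s l (cell p) q = contradiction p λ ()
  longer {c = suc c} r<s l p q with _ , q′ , lt ← below c r<s (inj₁ l) p =
    subst (_ <_) (cell-unique q′ q) lt

-- What ψ has settled on reaching column `c`. Rows are matched through their entry in this column,
-- since the index of a row is its first entry, which ψ chooses last.
Tails : Filling → Filling → ℕ → Set
Tails X Y c = ∀ {r s v} → Cell X r c v → Cell Y s c v → ∀ d → c ≤ d → entry X r d ≡ entry Y s d

Tails-sym : ∀ {X Y c} → Tails X Y c → Tails Y X c
Tails-sym t p q d l = sym (t q p d l)

part-≤ : ∀ {X Y c} → Tails X Y c → ∀ {r s v} → Cell X r c v → Cell Y s c v → part X r ≤ part Y s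
part-≤ {X} {Y} t {r} {s} p q = cell-≤-part {Y} {s}
  (cell (trans (sym (t p q (part X r) (cell-≤-part p))) (holds (last-cell p))))

-- The key looks only at the right end of a row, which lies within the known tail.
key-tails : ∀ {X Y c} → Tails X Y c → ∀ {r s v} → Cell X r c v → Cell Y s c v → key X r ≡ key Y s
key-tails {X} {Y} t {r} {s} p q = cong₂ _,_ same-part (cong (fromMaybe 0)
  (trans (t p q (part X r) (cell-≤-part p)) (cong (entry Y s) same-part)))
  where
  same-part : part X r ≡ part Y s
  same-part = ≤-antisym (part-≤ t p q) (part-≤ (Tails-sym {X} {Y} t) q p)

-- The predicate `P` on keys allows induction along `_≺_`: it is taken to be "before a given key" in
-- the hypothesis and "equal to a given key" in the conclusion.
LeftNeighboursAgree : Filling → Filling → ℕ → (Key → Set) → Set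
LeftNeighboursAgree X Y c P = ∀ {r s v a b} → P (key X r) →
  Cell X r (suc c) v → Cell Y s (suc c) v → Cell X r c a → Cell Y s c b → a ≡ b

-- Suppose `a < b`, and let `s′` be the row of `Y` with `a` in column `suc c`. If `s` precedes `s′`,
-- the entry `v` right of `b` must exceed `a`, although it follows `a` in a row of `X`. If `s′`
-- precedes `s`, it is long enough for `a` to have a right neighbour; by `ih` this neighbour stands
-- right of `a` in `X` too, hence in row `r`, and row `r` would precede itself.
left-neighbour-≮ : ∀ {X Y c} → Tableau X → Tableau Y → KeyCondition Y → SameColumns X Y →
  Tails X Y (suc (suc c)) → ∀ {r s v a b} → LeftNeighboursAgree X Y (suc c) (_≺ key X r) →
  Cell X r (suc (suc c)) v → Cell Y s (suc (suc c)) v → Cell X r (suc c) a → Cell Y s (suc c) b → ¬ a < b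
left-neighbour-≮ {X} {Y} {c} tX tY localY (f , g) tails {r} {s} {a = a} ih p q p₀ q₀ a<b =
  absurd (f (_ , p₀))
  where
  absurd : ¬ Occurs Y a (suc c)
  absurd (s′ , q₁) with key-total (Tableau.columns-distinct tY) q₀ q₁
  ... | inj₁ refl = <⇒≢ a<b (cell-unique q₁ q₀)
  ... | inj₂ (inj₁ prec) with localY prec q₀ q₁
  ...   | inj₁ b<a = <⇒≯ a<b b<a
  ...   | inj₂ (_ , q′ , lt) rewrite cell-unique q′ q = <⇒≱ lt (Tableau.rows-decrease tX p₀ p)
  absurd (s′ , q₁) | inj₂ (inj₂ prec)
    with _ , u ← cell-within {Y} {s′} (suc c) (≤-trans (cell-≤-part q) (≺⇒≥ prec))
    with r′ , w ← g (_ , u) with _ , w₀ ← cell-prefix {c = c} w (n≤1+n _)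
    with prec′ ← subst₂ _≺_ (sym (key-tails tails w u)) (sym (key-tails tails p q)) prec
    with refl ← ih prec′ w u w₀ q₁
    with refl ← Tableau.columns-distinct tX w₀ p₀ = ≺-irrefl _ prec′

part-≤-max : ∀ X r → part X r ≤ foldr _⊔_ 0 (map length X)
part-≤-max X r = All-row⁻ {P = λ R → length R ≤ foldr _⊔_ 0 (map length X)} z≤n (bounded X) r
  where
  bounded : ∀ X → All (λ R → length R ≤ foldr _⊔_ 0 (map length X)) X
  bounded []      = []
  bounded (R ∷ X) = m≤m⊔n (length R) _ ∷ All.map (λ l → ≤-trans l (m≤n⊔m (length R) _)) (bounded X)

key-determined : ∀ {X Y} → Tableau X → Tableau Y → KeyCondition X → KeyCondition Y →
  SameColumns X Y → X ≈ Y
key-determined {X} {Y} tX tY localX localY same@(f , g) = entries-agree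
  (λ { {c = zero} (cell p) → contradiction p λ () ; {c = suc c} p → transfer tX tY f (tails N 0 ≤-refl) p })
  (λ { {c = zero} (cell p) → contradiction p λ ()
     ; {c = suc c} p → transfer tY tX g (Tails-sym {X} {Y} (tails N 0 ≤-refl)) p })
  where
  N : ℕ
  N = foldr _⊔_ 0 (map length X)

  -- Going down along `_≺_` makes rows longer, so the well-founded measure subtracts the length from
  -- its maximum `N`.
  left-neighbours : ∀ {c} → Tails X Y (suc (suc c)) → ∀ {k : Key} →
    Acc (×-Lex _≡_ _<_ _<_) (N ∸ proj₁ k , proj₂ k) → LeftNeighboursAgree X Y (suc c) (_≡ k)
  left-neighbours {c} tails (acc rec) {r} {s} refl p q p₀ q₀ = ≤-antisym (≮⇒≥ b≮a) (≮⇒≥ a≮b)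
    where
    ih : LeftNeighboursAgree X Y (suc c) (_≺ key X r)
    ih {r = r′} prec = left-neighbours tails (rec (decrease prec)) refl
      where
      decrease : key X r′ ≺ key X r →
        ×-Lex _≡_ _<_ _<_ (N ∸ part X r′ , proj₂ (key X r′)) (N ∸ part X r , proj₂ (key X r))
      decrease (inj₁ l)       = inj₁ (∸-monoʳ-< l (part-≤-max X r′))
      decrease (inj₂ (e , l)) = inj₂ (cong (N ∸_) e , l)
    a≮b : _
    a≮b = left-neighbour-≮ tX tY localY same tails ih p q p₀ q₀
    b≮a : _
    b≮a = left-neighbour-≮ tY tX localX (SameColumns-sym same) (Tails-sym {X} {Y} tails)
      (λ prec q′ p′ q₁ p₁ → sym (ih
        (subst₂ _≺_ (sym (key-tails tails p′ q′)) (sym (key-tails tails p q)) prec) p′ q′ p₁ q₁))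
      q p q₀ p₀

  tails-step : ∀ {c} → Tails X Y (suc (suc c)) → Tails X Y (suc c)
  tails-step {c} tails {r} {s} {v} p q d l with m≤n⇒m<n∨m≡n l
  ... | inj₂ refl = trans (holds p) (sym (holds q))
  ... | inj₁ l′ with cell? {X} r (suc (suc c)) | cell? {Y} s (suc (suc c))
  -- The left neighbour of `w` is `v` in `X` and hence in `Y`; as `v` occurs only once in its column
  -- of `Y`, `w` lies in row `s`.
  ...   | inj₁ (w , p′) | _ with s′ , q′ ← f (_ , p′) with _ , q₀ ← cell-prefix {c = c} q′ (n≤1+n _)
        with refl ← left-neighbours tails (×-wellFounded <-wellFounded <-wellFounded _) refl p′ q′ p q₀
        with refl ← Tableau.columns-distinct tY q₀ q = tails p′ q′ d l′
  ...   | inj₂ ep | inj₁ (w , q′) with r′ , p′ ← g (_ , q′) with _ , p₀ ← cell-prefix {c = c} p′ (n≤1+n _)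
        with refl ← left-neighbours tails (×-wellFounded <-wellFounded <-wellFounded _) refl p′ q′ p₀ q
        with refl ← Tableau.columns-distinct tX p₀ p = contradiction p′ ep
  tails-step {c} tails {r} {s} {v} p q d l | inj₁ l′ | inj₂ ep | inj₂ eq = cells-agree {r = r}
    (λ p′ → contradiction (proj₂ (cell-prefix p′ l′)) ep)
    (λ q′ → contradiction (proj₂ (cell-prefix q′ l′)) eq)

  tails : ∀ n c → N ≤ c + n → Tails X Y (suc c)
  tails zero    c l {r} p _ rewrite +-identityʳ c =
    contradiction (≤-trans (cell-≤-part p) (part-≤-max X r)) (<⇒≱ (s≤s l))
  tails (suc n) c l = tails-step (tails n (suc c) (subst (N ≤_) (+-suc c n) l))

  -- In column 1 the entry is the row index, so tails matched through entries there lie in the same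
  -- row.
  transfer : ∀ {V W} → Tableau V → Tableau W → V ⊑ W → Tails V W 1 →
    ∀ {r c v} → Cell V r (suc c) v → Cell W r (suc c) v
  transfer tV tW h t {r} {c} p with _ , p₀ ← cell-prefix {c = 0} p (s≤s z≤n) =
    cell (trans (sym (t p₀ (first-columns-agree tV tW h p₀) (suc c) (s≤s z≤n))) (holds p))

QuasiKey₁-determined : DeterminedByColumns QuasiKey₁
QuasiKey₁-determined = record
  { positive         = λ k → QuasiKey.positive (QuasiKey₁.quasi-key k)
  ; rows-decrease    = λ k → QuasiKey.rows-decrease (QuasiKey₁.quasi-key k)
  ; columns-distinct = λ k → Tableau.columns-distinct (QuasiKey₁⇒Tableau k)
  ; determined       = λ k l → key-determined (QuasiKey₁⇒Tableau k) (QuasiKey₁⇒Tableau l)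
      (QuasiKey₁⇒KeyCondition k) (QuasiKey₁⇒KeyCondition l)
  }

-- The column-filling Γ

row-setRow-≡ : ∀ r R X → row (setRow (suc r) R X) (suc r) ≡ R
row-setRow-≡ zero    R []      = refl
row-setRow-≡ zero    R (_ ∷ _) = refl
row-setRow-≡ (suc r) R []      = trans (row-suc [] (setRow (suc r) R []) r) (row-setRow-≡ r R [])
row-setRow-≡ (suc r) R (S ∷ X) = trans (row-suc S (setRow (suc r) R X) r) (row-setRow-≡ r R X)

row-setRow-≢ : ∀ r R X s → s ≢ suc r → row (setRow (suc r) R X) s ≡ row X s
row-setRow-≢ r       R X       zero          _ = refl
row-setRow-≢ zero    R X       (suc zero)    n = contradiction refl n
row-setRow-≢ zero    R []      (suc (suc s)) _ =
  trans (row-suc R [] s) (trans (row-[] (suc s)) (sym (row-[] (suc (suc s)))))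
row-setRow-≢ zero    R (S ∷ X) (suc (suc s)) _ = trans (row-suc R X s) (sym (row-suc S X s))
row-setRow-≢ (suc r) R []      (suc zero)    _ = refl
row-setRow-≢ (suc r) R (_ ∷ _) (suc zero)    _ = refl
row-setRow-≢ (suc r) R []      (suc (suc s)) n =
  trans (row-suc [] (setRow (suc r) R []) s)
    (trans (row-setRow-≢ r R [] (suc s) (n ∘ cong suc))
      (trans (row-[] (suc s)) (sym (row-[] (suc (suc s))))))
row-setRow-≢ (suc r) R (S ∷ X) (suc (suc s)) n =
  trans (row-suc S (setRow (suc r) R X) s)
    (trans (row-setRow-≢ r R X (suc s) (n ∘ cong suc)) (sym (row-suc S X s)))

setRow-same : ∀ {r} R X → 1 ≤ r → row (setRow r R X) r ≡ R
setRow-same {suc r} R X _ = row-setRow-≡ r R X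

setRow-other : ∀ r {s} R X → s ≢ r → row (setRow r R X) s ≡ row X s
setRow-other zero        R X _ = refl
setRow-other (suc r) {s} R X n = row-setRow-≢ r R X s n

module _ {R : List ℕ} {X : Filling} where

  setRow-new : ∀ {r d v} → 1 ≤ r → at R d ≡ just v → Cell (setRow r R X) r d v
  setRow-new {d = d} r≥1 p = cell (trans (cong (λ S → at S d) (setRow-same R X r≥1)) p)

  setRow-old : ∀ {r s d v} → s ≢ r → Cell X s d v → Cell (setRow r R X) s d v
  setRow-old {r} {d = d} n (cell p) = cell (trans (cong (λ S → at S d) (setRow-other r R X n)) p)

  setRow-cell : ∀ {r s d v} → 1 ≤ r → Cell (setRow r R X) s d v →
    (s ≡ r × at R d ≡ just v) ⊎ (s ≢ r × Cell X s d v)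
  setRow-cell {r} {s} {d} r≥1 (cell p) with s ≟ r
  ... | yes refl = inj₁ (refl , trans (sym (cong (λ S → at S d) (setRow-same R X r≥1))) p)
  ... | no  n    = inj₂ (n , cell (trans (sym (cong (λ S → at S d) (setRow-other r R X n))) p))

at-snoc-old : ∀ (xs : List ℕ) e d {v} → at xs d ≡ just v → at (xs ++ e ∷ []) d ≡ just v
at-snoc-old (x ∷ xs) e (suc zero)    p = p
at-snoc-old (x ∷ xs) e (suc (suc d)) p = at-snoc-old xs e (suc d) p

at-snoc-new : ∀ (xs : List ℕ) e → at (xs ++ e ∷ []) (suc (length xs)) ≡ just e
at-snoc-new []       e = refl
at-snoc-new (x ∷ xs) e = at-snoc-new xs e

at-snoc : ∀ (xs : List ℕ) e d {v} → at (xs ++ e ∷ []) d ≡ just v →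
  (d ≡ suc (length xs) × v ≡ e) ⊎ at xs d ≡ just v
at-snoc []       e (suc zero)    refl = inj₁ (refl , refl)
at-snoc []       e (suc (suc d)) ()
at-snoc (x ∷ xs) e (suc zero)    p = inj₂ p
at-snoc (x ∷ xs) e (suc (suc d)) p with at-snoc xs e (suc d) p
... | inj₁ (q , r) = inj₁ (cong suc q , r)
... | inj₂ q       = inj₂ q

-- The effect of one `place`. The field `lowest` becomes the `SkylineCondition`; the last two fields
-- keep the count of free positions in `fill-column`.
record Placed (c e : ℕ) (X X′ : Filling) : Set where
  field
    target        : ℕ
    left          : ∃[ z ] Cell X target c z × e ≤ z
    new           : Cell X′ target (suc c) e
    old           : ∀ {r d v} → Cell X r d v → Cell X′ r d v
    only          : ∀ {r d v} → Cell X′ r d v → (r ≡ target × d ≡ suc c × v ≡ e) ⊎ Cell X r d v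
    lowest        : ∀ {r x} → r < target → Cell X r c x → x < e ⊎ ∃[ y ] Cell X r (suc c) y
    column-before : column X′ c ≡ column X c
    column-length : length (column X′ (suc c)) ≡ suc (length (column X (suc c)))

Placed-∷ : ∀ {c e R X X′} → (∀ {x} → at R c ≡ just x → x < e ⊎ ∃[ y ] at R (suc c) ≡ just y) →
  Placed c e X X′ → Placed c e (R ∷ X) (R ∷ X′)
Placed-∷ {c} {e} {R} {X} {X′} refuses p with Placed.target p in target≡
... | zero with _ , l , _ ← Placed.left p =
  contradiction (cell-row≥1 l) (subst (λ s → ¬ 1 ≤ s) (sym target≡) λ ())
... | suc s = record
  { target = suc (suc s)
  ; left   = let z , l , e≤z = left in z , cell-suc⁺ (subst (λ r → Cell X r c z) target≡ l) , e≤z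
  ; new    = cell-suc⁺ (subst (λ r → Cell X′ r (suc c) e) target≡ new)
  ; old    = old′
  ; only   = only′
  ; lowest = lowest′
  ; column-before = cong (maybe′ _∷_ id (at R c)) column-before
  ; column-length = column-length′
  }
  where
  open Placed p
  old′ : ∀ {r d v} → Cell (R ∷ X) r d v → Cell (R ∷ X′) r d v
  old′ {zero}        q        = contradiction (cell-row≥1 q) λ ()
  old′ {suc zero}    (cell q) = cell q
  old′ {suc (suc r)} q        = cell-suc⁺ (old (cell-suc⁻ q))
  only′ : ∀ {r d v} → Cell (R ∷ X′) r d v →
    (r ≡ suc (suc s) × d ≡ suc c × v ≡ e) ⊎ Cell (R ∷ X) r d v
  only′ {zero}     q        = contradiction (cell-row≥1 q) λ ()
  only′ {suc zero} (cell q) = inj₂ (cell q)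
  only′ {suc (suc r)} q with only (cell-suc⁻ q)
  ... | inj₁ (a , b) = inj₁ (cong suc (trans a target≡) , b)
  ... | inj₂ q′      = inj₂ (cell-suc⁺ q′)
  lowest′ : ∀ {r x} → r < suc (suc s) → Cell (R ∷ X) r c x → x < e ⊎ ∃[ y ] Cell (R ∷ X) r (suc c) y
  lowest′ {zero}     _ q        = contradiction (cell-row≥1 q) λ ()
  lowest′ {suc zero} _ (cell q) with refuses q
  ... | inj₁ lt      = inj₁ lt
  ... | inj₂ (y , t) = inj₂ (y , cell t)
  lowest′ {suc (suc r)} (s≤s lt) q with lowest (subst (suc r <_) (sym target≡) lt) (cell-suc⁻ q)
  ... | inj₁ lt      = inj₁ lt
  ... | inj₂ (y , t) = inj₂ (y , cell-suc⁺ t)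
  column-length′ : length (column (R ∷ X′) (suc c)) ≡ suc (length (column (R ∷ X) (suc c)))
  column-length′ with at R (suc c)
  ... | just _  = cong suc column-length
  ... | nothing = column-length

Placed-here : ∀ {c e z R X} → at R (suc c) ≡ just z → at R (suc (suc c)) ≡ nothing → e ≤ z →
  Placed (suc c) e (R ∷ X) ((R ++ e ∷ []) ∷ X)
Placed-here {c} {e} {z} {R} {X} p q e≤z = record
  { target = 1
  ; left   = z , cell p , e≤z
  ; new    = cell (subst (λ d → at (R ++ e ∷ []) d ≡ just e) full (at-snoc-new R e))
  ; old    = old′
  ; only   = only′
  ; lowest = λ { {zero} _ t → contradiction (cell-row≥1 t) λ () ; {suc _} (s≤s ()) _ }
  ; column-before = column-before′
  ; column-length = column-length′
  }
  where
  full : suc (length R) ≡ suc (suc c)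
  full with suc (suc c) ≤? length R
  ... | yes l = contradiction q (just≢nothing (proj₂ (at-just R (suc c) l)))
  ... | no  l = cong suc (≤-antisym (s≤s⁻¹ (≰⇒> l)) (at-≤-length R (suc c) p))
  old′ : ∀ {r d v} → Cell (R ∷ X) r d v → Cell ((R ++ e ∷ []) ∷ X) r d v
  old′ {zero}            t        = contradiction (cell-row≥1 t) λ ()
  old′ {suc zero}    {d} (cell t) = cell (at-snoc-old R e d t)
  old′ {suc (suc r)}     t        = cell-suc⁺ (cell-suc⁻ t)
  only′ : ∀ {r d v} → Cell ((R ++ e ∷ []) ∷ X) r d v → (r ≡ 1 × d ≡ suc (suc c) × v ≡ e) ⊎ Cell (R ∷ X) r d v
  only′ {zero}          t = contradiction (cell-row≥1 t) λ ()
  only′ {suc zero}  {d} (cell t) with at-snoc R e d t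
  ... | inj₁ (a , b) = inj₁ (refl , trans a full , b)
  ... | inj₂ t′      = inj₂ (cell t′)
  only′ {suc (suc r)}   t = inj₂ (cell-suc⁺ (cell-suc⁻ t))
  column-before′ : column ((R ++ e ∷ []) ∷ X) (suc c) ≡ column (R ∷ X) (suc c)
  column-before′ rewrite at-snoc-old R e (suc c) p | p = refl
  column-length′ : length (column ((R ++ e ∷ []) ∷ X) (suc (suc c))) ≡
    suc (length (column (R ∷ X) (suc (suc c))))
  column-length′ rewrite subst (λ d → at (R ++ e ∷ []) d ≡ just e) full (at-snoc-new R e) | q = refl

place-spec : ∀ {c e} X → length (column X (suc (suc c))) < count e (column X (suc c)) →
  Placed (suc c) e X (place (suc c) X e)
place-spec {c} {e} (R ∷ X) l with at R (suc c) in p | at R (suc (suc c)) in q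
... | nothing | just _  =
  contradiction p (just≢nothing (proj₂ (at-prefix R {c} {suc (suc c)} (n≤1+n _) q)))
... | nothing | nothing = Placed-∷ (λ t → contradiction p (just≢nothing t)) (place-spec X l)
... | just z  | just y  = Placed-∷ (λ _ → inj₂ (y , q)) (place-spec X (s≤s⁻¹ (≤-trans l at-most)))
  where
  at-most : count e (z ∷ column X (suc c)) ≤ suc (count e (column X (suc c)))
  at-most with e ≤? z
  ... | yes e≤z = ≤-reflexive (count-accept (column X (suc c)) e≤z)
  ... | no  e≰z = m≤n⇒m≤1+n (≤-reflexive (count-reject (column X (suc c)) (≰⇒> e≰z)))
... | just z  | nothing with e ≤ᵇ z in b
...   | true  = Placed-here p q (≤ᵇ⇒≤ e z (subst T (sym b) _))
-- The count in `l` is decided by the same `e ≤ᵇ z`, so `z` has already dropped out of it.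
...   | false = Placed-∷ (λ t → inj₁ (subst (_< e) (just-injective (trans (sym p) t)) z<e))
    (place-spec X l)
  where
  z<e : z < e
  z<e = ≰⇒> λ e≤z → subst T b (≤⇒≤ᵇ e≤z)

record Skyline (c : ℕ) (X : Filling) : Set where
  field
    tableau   : Tableau X
    condition : SkylineCondition X
    bounded   : ∀ {r d v} → Cell X r d v → d ≤ c

-- Everything already in the column is larger than `e`. This keeps the column distinct, and it gives
-- the second alternative of the condition for a lower row that refused `e` because its position was
-- filled.
place-skyline : ∀ {c e X X′} → Placed (suc c) e X X′ → 1 ≤ e →
  (∀ {r v} → Cell X r (suc (suc c)) v → e < v) →
  Skyline (suc (suc c)) X → Skyline (suc (suc c)) X′
place-skyline {c} {e} {X} {X′} placed e≥1 smaller sky = record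
  { tableau = record
    { positive         = positive′
    ; rows-decrease    = rows-decrease′
    ; columns-distinct = columns-distinct′
    ; first-row-index  = first-row-index′
    }
  ; condition = condition′
  ; bounded   = bounded′
  }
  where
  open Placed placed
  open Skyline sky
  open Tableau tableau

  positive′ : ∀ {r d v} → Cell X′ r d v → 1 ≤ v
  positive′ p with only p
  ... | inj₁ (_ , _ , refl) = e≥1
  ... | inj₂ p′             = positive p′

  rows-decrease′ : ∀ {r d x y} → Cell X′ r d x → Cell X′ r (suc d) y → y ≤ x
  rows-decrease′ p q with only p | only q
  ... | inj₂ p′             | inj₂ q′ = rows-decrease p′ q′
  ... | inj₂ p′             | inj₁ (refl , refl , refl) with _ , l , e≤z ← left =
    ≤-trans e≤z (≤-reflexive (cell-unique l p′))
  ... | inj₁ (_ , refl , _) | inj₂ q′ = contradiction (bounded q′) (<-irrefl refl)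
  ... | inj₁ (_ , refl , _) | inj₁ (_ , () , _)

  columns-distinct′ : DistinctCells X′
  columns-distinct′ p q with only p | only q
  ... | inj₂ p′                | inj₂ q′                = columns-distinct p′ q′
  ... | inj₂ p′                | inj₁ (_ , refl , refl) = contradiction (smaller p′) (<-irrefl refl)
  ... | inj₁ (_ , refl , refl) | inj₂ q′                = contradiction (smaller q′) (<-irrefl refl)
  ... | inj₁ (refl , _)        | inj₁ (refl , _)        = refl

  first-row-index′ : ∀ {r v} → Cell X′ r 1 v → v ≡ r
  first-row-index′ p with only p
  ... | inj₂ p′           = first-row-index p′
  ... | inj₁ (_ , () , _)

  condition′ : SkylineCondition X′
  condition′ r<s p q with only p | only q
  ... | inj₁ (_ , refl , _) | inj₁ (_ , () , _)
  ... | inj₁ (_ , refl , _) | inj₂ q′ = contradiction (bounded q′) (<-irrefl refl)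
  ... | inj₂ p′ | inj₂ q′ with condition r<s p′ q′
  ...   | inj₁ lt            = inj₁ lt
  ...   | inj₂ (z , t , lt)  = inj₂ (z , old t , lt)
  condition′ r<s p q | inj₂ p′ | inj₁ (refl , refl , refl) with lowest r<s p′
  ...   | inj₁ lt      = inj₁ lt
  ...   | inj₂ (y , t) = inj₂ (y , old t , smaller t)

  bounded′ : ∀ {r d v} → Cell X′ r d v → d ≤ suc (suc c)
  bounded′ p with only p
  ... | inj₁ (_ , refl , _) = ≤-refl
  ... | inj₂ p′             = bounded p′

-- The hypothesis on counts is Hall's condition for a partly filled column: the entries already
-- placed exceed every `t` still to come, so all of them count. Placing `e` moves one unit from the
-- second summand to the first.
fill-column : ∀ {c} X C → StrictlyDecreasing C → All (1 ≤_) C →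
  (∀ {t} → t ∈ C → length (column X (suc (suc c))) + count t C ≤ count t (column X (suc c))) →
  (∀ {t r v} → t ∈ C → Cell X r (suc (suc c)) v → t < v) →
  Skyline (suc (suc c)) X →
  let X′ = foldl (place (suc c)) X C in
  Skyline (suc (suc c)) X′ × (∀ {r d v} → Cell X r d v → Cell X′ r d v) ×
  (∀ {r d v} → Cell X′ r d v → (d ≡ suc (suc c) × v ∈ C) ⊎ Cell X r d v) ×
  (∀ {v} → v ∈ C → Occurs X′ v (suc (suc c)))
fill-column X [] _ _ _ _ sky = sky , id , inj₂ , λ ()
fill-column {c} X (e ∷ C) (e> ∷ C>) (e≥1 ∷ C≥1) room smaller sky =
  let sky′ , old′ , only′ , all′ = fill-column (place (suc c) X e) C C> C≥1 room′ smaller′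
        (place-skyline placed e≥1 (smaller (here refl)) sky)
  in sky′ , old′ ∘ old , (λ p → only″ (only′ p)) ,
     λ { (here refl) → target , old′ new ; (there v∈C) → all′ v∈C }
  where
  placed : Placed (suc c) e X (place (suc c) X e)
  -- `e` counts itself in `count e (e ∷ C)`, which makes the inequality strict.
  placed = place-spec X (≤-trans (≤-reflexive (+-comm 1 _))
    (≤-trans (+-monoʳ-≤ _ (count-positive {e} {e} {e ∷ C} (here refl) ≤-refl)) (room (here refl))))
  open Placed placed

  room′ : ∀ {t} → t ∈ C → length (column (place (suc c) X e) (suc (suc c))) + count t C ≤
    count t (column (place (suc c) X e) (suc c))
  room′ {t} t∈C rewrite column-before | column-length =
    subst (_≤ count t (column X (suc c))) eq (room (there t∈C))
    where
    eq : length (column X (suc (suc c))) + count t (e ∷ C) ≡ suc (length (column X (suc (suc c))) + count t C)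
    eq = trans (cong (length (column X (suc (suc c))) +_) (count-accept C (<⇒≤ (All.lookup e> t∈C))))
      (+-suc _ _)

  smaller′ : ∀ {t r v} → t ∈ C → Cell (place (suc c) X e) r (suc (suc c)) v → t < v
  smaller′ t∈C p with only p
  ... | inj₁ (_ , _ , refl) = All.lookup e> t∈C
  ... | inj₂ p′             = smaller (there t∈C) p′

  only″ : ∀ {r d v} → (d ≡ suc (suc c) × v ∈ C) ⊎ Cell (place (suc c) X e) r d v →
    (d ≡ suc (suc c) × v ∈ e ∷ C) ⊎ Cell X r d v
  only″ (inj₁ (eq , v∈C)) = inj₁ (eq , there v∈C)
  only″ (inj₂ p) with only p
  ... | inj₁ (_ , eq , refl) = inj₁ (eq , here refl)
  ... | inj₂ p′              = inj₂ p′

-- `C` is the column of the reverse tableau placed last. Its entries stand in column `suc c` of `X`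
-- in another order, so what is carried along is domination, which ignores order.
fill-columns : ∀ {c} X C Cs → Dominates (column X (suc c)) C → Linked Dominates (C ∷ Cs) →
  All StrictlyDecreasing Cs → All (All (1 ≤_)) Cs → Skyline (suc c) X →
  let F = fillColumns (suc c) X Cs in
  Tableau F × SkylineCondition F × (∀ {r d v} → Cell X r d v → Cell F r d v) ×
  (∀ {r d v} → Cell F r d v → (∃[ k ] d ≡ suc c + suc k × v ∈ row Cs (suc k)) ⊎ Cell X r d v) ×
  (∀ k {v} → v ∈ row Cs (suc k) → Occurs F v (suc c + suc k))
fill-columns X C [] _ _ _ _ sky =
  Skyline.tableau sky , Skyline.condition sky , id , inj₂ ,
  λ k {v} v∈ → case subst (v ∈_) (row-[] (suc k)) v∈ of λ ()
fill-columns {c} X C₀ (C ∷ Cs) dom (dom₀ ∷ doms) (C> ∷ Cs>) (C≥1 ∷ Cs≥1) sky =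
  let sky′ , old , only , all = fill-column X C C> C≥1 room (λ _ p → contradiction p none) weaken
      tab , cond , old′ , only′ , all′ = fill-columns (foldl (place (suc c)) X C) C Cs
        (λ t → count-⊆ (decreasing⇒unique C>)
          (column-unique (Tableau.columns-distinct (Skyline.tableau sky′)) (suc (suc c)))
          λ v∈C → column-∈⁺ (proj₂ (all v∈C)))
        doms Cs> Cs≥1 sky′
  in tab , cond , old′ ∘ old ,
     (λ p → split only (only′ p)) ,
     λ { zero {v} v∈C → subst (Occurs _ v) (sym (+-comm (suc c) 1)) (let r , p = all v∈C in r , old′ p)
       ; (suc k) {v} v∈ → subst (Occurs _ v) (sym (+-suc (suc c) (suc k)))
           (all′ k (subst (v ∈_) (row-suc C Cs k) v∈)) }
  where
  none : ∀ {r} → Empty X r (suc (suc c))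
  none p = <-irrefl refl (Skyline.bounded sky p)

  weaken : Skyline (suc (suc c)) X
  weaken = record
    { tableau   = Skyline.tableau sky
    ; condition = Skyline.condition sky
    ; bounded   = λ p → m≤n⇒m≤1+n (Skyline.bounded sky p)
    }

  no-column : column X (suc (suc c)) ≡ []
  no-column with column X (suc (suc c)) in eq
  ... | []    = refl
  ... | v ∷ _ = contradiction
    (proj₂ (column-∈⁻ X (suc (suc c)) (subst (v ∈_) (sym eq) (here refl)))) none

  room : ∀ {t} → t ∈ C → length (column X (suc (suc c))) + count t C ≤ count t (column X (suc c))
  room {t} _ rewrite no-column = ≤-trans (dom₀ t) (dom t)

  split : ∀ {X₁ : Filling} {r d v} →
    (∀ {r d v} → Cell X₁ r d v → (d ≡ suc (suc c) × v ∈ C) ⊎ Cell X r d v) →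
    (∃[ k ] d ≡ suc (suc c) + suc k × v ∈ row Cs (suc k)) ⊎ Cell X₁ r d v →
    (∃[ k ] d ≡ suc c + suc k × v ∈ row (C ∷ Cs) (suc k)) ⊎ Cell X r d v
  split only (inj₁ (k , refl , v∈)) =
    inj₁ (suc k , sym (+-suc (suc c) (suc k)) , subst (_ ∈_) (sym (row-suc C Cs k)) v∈)
  split only (inj₂ p) with only p
  ... | inj₁ (refl , v∈C) = inj₁ (0 , +-comm 1 (suc c) , v∈C)
  ... | inj₂ p′           = inj₂ p′

module _ {V : Filling} (v : RevSSYT V) where
  columns-decreasing : All StrictlyDecreasing (columns V)
  columns-decreasing = All.applyUpTo⁺₂ (λ c → column V (suc c)) _ λ c → column-decreasing v (suc c)

  columns-positive : All (All (1 ≤_)) (columns V)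
  columns-positive = All.applyUpTo⁺₂ (λ c → column V (suc c)) _ λ c → All.tabulate λ p →
    cells-positive (RevSSYT.positive v) (proj₂ (column-∈⁻ V (suc c) p))

  columns-dominate : Linked Dominates (columns V)
  columns-dominate = Linked.applyUpTo⁺₂ (λ c → column V (suc c)) _
    (column-dominates (RevSSYT.rows-decrease v))

Occurs⇒∈ : ∀ {V v} c → Occurs V v c → v ∈ row (columns V) c
Occurs⇒∈ {V} {v} c (r , p) = subst (v ∈_) (sym (row-columns V c)) (column-∈⁺ p)

∈⇒Occurs : ∀ {V v} c → v ∈ row (columns V) c → Occurs V v c
∈⇒Occurs {V} {v} c v∈ = column-∈⁻ V c (subst (v ∈_) (row-columns V c) v∈)

first-column : List ℕ → Filling
first-column = foldr (λ i → setRow i (i ∷ [])) []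

first-column-cell : ∀ {C r d v} → All (1 ≤_) C → Cell (first-column C) r d v → r ∈ C × d ≡ 1 × v ≡ r
first-column-cell {[]} _ p = contradiction p cell-[]
first-column-cell {i ∷ C} {r} {d} (i≥1 ∷ C≥1) p with setRow-cell {i ∷ []} {first-column C} i≥1 p
... | inj₁ (refl , q) with d | q
...   | suc zero | refl = here refl , refl , refl
...   | suc (suc d) | ()
first-column-cell {i ∷ C} (i≥1 ∷ C≥1) p | inj₂ (_ , q) with r∈C , e ← first-column-cell C≥1 q = there r∈C , e

first-column-∈ : ∀ {C v} → All (1 ≤_) C → v ∈ C → Cell (first-column C) v 1 v
first-column-∈ {i ∷ C} {v} (i≥1 ∷ C≥1) v∈C with v ≟ i
first-column-∈ {i ∷ C} {v} (i≥1 ∷ C≥1) _ | yes refl = setRow-new {i ∷ []} i≥1 refl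
first-column-∈ {i ∷ C} (_ ∷ _) (here refl) | no n = contradiction refl n
first-column-∈ {i ∷ C} (_ ∷ C≥1) (there v∈C) | no n = setRow-old n (first-column-∈ C≥1 v∈C)

first-column-skyline : ∀ {C} → All (1 ≤_) C → Skyline 1 (first-column C)
first-column-skyline {C} C≥1 = record
  { tableau = record
    { positive         = λ p → let r∈C , _ , v≡r = inv p in subst (1 ≤_) (sym v≡r) (All.lookup C≥1 r∈C)
    ; rows-decrease    = λ p q → case inv p of λ { (_ , refl , _) → case inv q of λ { (_ , () , _) } }
    ; columns-distinct = λ p q → trans (sym (proj₂ (proj₂ (inv p)))) (proj₂ (proj₂ (inv q)))
    ; first-row-index  = λ p → proj₂ (proj₂ (inv p))
    }
  ; condition = λ _ p q → case inv p of λ { (_ , refl , _) → case inv q of λ { (_ , () , _) } }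
  ; bounded   = λ p → ≤-reflexive (proj₁ (proj₂ (inv p)))
  }
  where
  inv : ∀ {r d v} → Cell (first-column C) r d v → r ∈ C × d ≡ 1 × v ≡ r
  inv = first-column-cell C≥1

Γ-image : ∀ {V} → RevSSYT V → ASSF (Γ V) × SameColumns (Γ V) V
-- `Γ` matches on `columns V`, so every fact about `columns V` is abstracted together with it.
Γ-image {V} v with columns V | columns-decreasing v | columns-positive v | columns-dominate v
                 | Occurs⇒∈ {V} | ∈⇒Occurs {V}
... | [] | _ | _ | _ | occ | _ =
  SkylineCondition⇒ASSF tableau-[] (λ _ p → contradiction p cell-[]) ,
  (λ { (_ , p) → contradiction p cell-[] }) ,
  λ {_} {c} o → case subst (_ ∈_) (row-[] c) (occ c o) of λ ()
... | C ∷ Cs | C> ∷ Cs> | C≥1 ∷ Cs≥1 | doms | occ | occ⁻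
  with tab , cond , old , only , all ← fill-columns (first-column C) C Cs
    (λ t → count-⊆ (decreasing⇒unique C>)
      (column-unique (Tableau.columns-distinct (Skyline.tableau (first-column-skyline C≥1))) 1)
      λ v∈C → column-∈⁺ (first-column-∈ C≥1 v∈C))
    doms Cs> Cs≥1 (first-column-skyline C≥1) =
  SkylineCondition⇒ASSF tab cond , image⊑ , ⊑image
  where
  F : Filling
  F = fillColumns 1 (first-column C) Cs
  image⊑ : F ⊑ V
  image⊑ (r , p) with only p
  ... | inj₁ (k , refl , v∈) = occ⁻ (suc (suc k)) (subst (_ ∈_) (sym (row-suc C Cs k)) v∈)
  ... | inj₂ q with r∈C , refl , refl ← first-column-cell C≥1 q = occ⁻ 1 r∈C
  ⊑image : V ⊑ F
  ⊑image {v} {c} o with c | occ c o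
  ... | zero        | ()
  ... | suc zero    | v∈ = v , old (first-column-∈ C≥1 v∈)
  ... | suc (suc k) | v∈ = all k (subst (v ∈_) (row-suc C Cs k) v∈)

-- The row-filling ψ

smallest-nothing : ∀ {xs} → smallest xs ≡ nothing → xs ≡ []
smallest-nothing {[]} _ = refl

foldr-⊓-∈ : ∀ x xs → foldr _⊓_ x xs ∈ x ∷ xs
foldr-⊓-∈ x []       = here refl
foldr-⊓-∈ x (y ∷ ys) with ⊓-sel y (foldr _⊓_ x ys)
... | inj₁ e = there (here e)
... | inj₂ e with foldr-⊓-∈ x ys
...   | here f  = here (trans e f)
...   | there p = there (there (subst (_∈ ys) (sym e) p))

foldr-⊓-≤ : ∀ x xs → All (foldr _⊓_ x xs ≤_) (x ∷ xs)
foldr-⊓-≤ x []       = ≤-refl ∷ []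
foldr-⊓-≤ x (y ∷ ys) with p ∷ ps ← foldr-⊓-≤ x ys =
  ≤-trans (m⊓n≤n y _) p ∷ m⊓n≤m y _ ∷ All.map (≤-trans (m⊓n≤n y _)) ps

smallest-just : ∀ {xs m} → smallest xs ≡ just m → m ∈ xs × (∀ {x} → x ∈ xs → m ≤ x)
smallest-just {x ∷ xs} refl = foldr-⊓-∈ x xs , All.lookup (foldr-⊓-≤ x xs)

-- With nothing chosen to the right every entry fits; this merges the two clauses of `choose`.
Fits : List ℕ → ℕ → Set
Fits ys x = ∀ {z} → at ys 1 ≡ just z → z ≤ x

fits? : ∀ ys x → Fits ys x ⊎ ∃[ z ] at ys 1 ≡ just z × x < z
fits? []       x = inj₁ λ ()
fits? (z ∷ ys) x with z ≤? x
... | yes z≤x = inj₁ λ { refl → z≤x }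
... | no  z≰x = inj₂ (z , refl , ≰⇒> z≰x)

choose-just : ∀ ys {C y} → choose ys C ≡ just y → y ∈ C × Fits ys y × (∀ {x} → x ∈ C → Fits ys x → y ≤ x)
choose-just [] e with y∈C , least ← smallest-just e = y∈C , (λ ()) , λ x∈C _ → least x∈C
choose-just (z ∷ ys) e with y∈ , least ← smallest-just e with y∈C , z≤y ← ∈-filter⁻ (z ≤?_) y∈ =
  y∈C , (λ { refl → z≤y }) , λ x∈C fits → least (∈-filter⁺ (z ≤?_) x∈C (fits refl))

choose-nothing : ∀ ys {C x} → choose ys C ≡ nothing → x ∈ C → ¬ Fits ys x
choose-nothing [] {C} e x∈C _ with refl ← smallest-nothing {C} e = case x∈C of λ ()
choose-nothing (z ∷ ys) {C} {x} e x∈C fits =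
  case subst (x ∈_) (smallest-nothing e) (∈-filter⁺ (z ≤?_) x∈C (fits refl)) of λ ()

-- A trace of `extractRow` without its fallback: a row may end only where all remaining columns are
-- empty.
data Extract : Columns → List ℕ → Columns → Set where
  none : ∀ {Cs} → All (_≡ []) Cs → Extract Cs [] Cs
  pick : ∀ {C Cs Cs′ y ys} → y ∈ C → Fits ys y → (∀ {x} → x ∈ C → Fits ys x → y ≤ x) →
    Extract Cs ys Cs′ → Extract (C ∷ Cs) (y ∷ ys) (remove y C ∷ Cs′)

count-witness : ∀ {t xs} → 0 < count t xs → ∃[ x ] x ∈ xs × t ≤ x
count-witness {t} {xs} l with filter (t ≤?_) xs in eq
... | x ∷ _ = x , ∈-filter⁻ (t ≤?_) (subst (x ∈_) (sym eq) (here refl))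

-- If `y` was chosen from the next column, domination at threshold `y` provides an entry of `C` that
-- fits. So the choice fails only when `C` and all columns after it are empty.
extractRow-spec : ∀ Cs → Linked Dominates Cs →
  Extract Cs (proj₁ (extractRow Cs)) (proj₂ (extractRow Cs))
extractRow-spec []       _ = none []
extractRow-spec (C ∷ Cs) dom with extractRow Cs | extractRow-spec Cs (Linked.tail dom)
... | ys , Cs′ | spec with choose ys C in eq
...   | just y = let y∈C , fits , least = choose-just ys eq in pick y∈C fits least spec
extractRow-spec (C ∷ Cs) dom | .[] , .Cs | none empty | nothing =
  none (smallest-nothing eq ∷ empty)
extractRow-spec (C ∷ D ∷ Cs) (dom ∷ _) | .(_ ∷ _) , _ | pick {y = y} {ys = ys} y∈D _ _ _ | nothing
  with x , x∈C , y≤x ← count-witness {y} {C} (≤-trans (count-positive y∈D ≤-refl) (dom y)) =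
  contradiction (λ { refl → y≤x }) (choose-nothing (y ∷ ys) eq x∈C)

empty-columns : ∀ {Cs} → All (_≡ []) Cs → ∀ d {v} → v ∉ row Cs d
empty-columns empty d {v} v∈ = case subst (v ∈_) (All-row⁻ {P = _≡ []} refl empty d) v∈ of λ ()

Extract-∈ : ∀ {Cs ys Cs′} → Extract Cs ys Cs′ → ∀ d {v} → v ∈ row Cs d → v ∈ row Cs′ d ⊎ at ys d ≡ just v
Extract-∈ (none _) d v∈ = inj₁ v∈
Extract-∈ (pick {y = y} _ _ _ _) (suc zero) {v} v∈ with v ≟ y
... | yes refl = inj₂ refl
... | no  v≢y  = inj₁ (∈-remove⁺ v∈ v≢y)
Extract-∈ (pick {C} {Cs} {Cs′} {y} _ _ _ ex) (suc (suc d)) {v} v∈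
  with Extract-∈ ex (suc d) (subst (v ∈_) (row-suc C Cs d) v∈)
... | inj₁ v∈′ = inj₁ (subst (v ∈_) (sym (row-suc (remove y C) Cs′ d)) v∈′)
... | inj₂ e   = inj₂ e

Extract-∈⁻ : ∀ {Cs ys Cs′} → Extract Cs ys Cs′ → ∀ d {v} → v ∈ row Cs′ d → v ∈ row Cs d × at ys d ≢ just v
Extract-∈⁻ (none _) d v∈ = v∈ , λ e → just≢nothing e (at-[] d)
Extract-∈⁻ (pick {C} _ _ _ _) (suc zero) v∈ with v∈C , v≢y ← ∈-remove⁻ {xs = C} v∈ =
  v∈C , λ e → v≢y (sym (just-injective e))
Extract-∈⁻ (pick {C} {Cs} {Cs′} {y} _ _ _ ex) (suc (suc d)) {v} v∈
  with v∈′ , n ← Extract-∈⁻ ex (suc d) (subst (v ∈_) (row-suc (remove y C) Cs′ d) v∈) =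
  subst (v ∈_) (sym (row-suc C Cs d)) v∈′ , n

Extract-at : ∀ {Cs ys Cs′} → Extract Cs ys Cs′ → ∀ d {v} → at ys d ≡ just v → v ∈ row Cs d
Extract-at (none _) d e = contradiction (at-[] d) (just≢nothing e)
Extract-at (pick y∈C _ _ _) (suc zero) refl = y∈C
Extract-at (pick {C} {Cs} _ _ _ ex) (suc (suc d)) {v} e =
  subst (v ∈_) (sym (row-suc C Cs d)) (Extract-at ex (suc d) e)

Extract-longest : ∀ {Cs ys Cs′} → Extract Cs ys Cs′ → ∀ d {v} → v ∈ row Cs d → ∃[ y ] at ys d ≡ just y
Extract-longest (none empty) d v∈ = contradiction v∈ (empty-columns empty d)
Extract-longest (pick {y = y} _ _ _ _) (suc zero) v∈ = y , refl
Extract-longest (pick {C} {Cs} _ _ _ ex) (suc (suc d)) {v} v∈ =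
  Extract-longest ex (suc d) (subst (v ∈_) (row-suc C Cs d) v∈)

-- A leftover `v` either fitted and lost to the smaller `y`, or did not fit because the entry right
-- of `y` exceeds it. This is the source of `KeyCondition`.
Extract-greedy : ∀ {Cs ys Cs′} → Extract Cs ys Cs′ → ∀ d {v y} → v ∈ row Cs′ d → at ys d ≡ just y →
  y < v ⊎ ∃[ z ] at ys (suc d) ≡ just z × v < z
Extract-greedy (none _) d _ e = contradiction (at-[] d) (just≢nothing e)
Extract-greedy (pick {C} {ys = ys} _ _ least _) (suc zero) {v} v∈ refl
  with v∈C , v≢y ← ∈-remove⁻ {xs = C} v∈ with fits? ys v
... | inj₁ fits  = inj₁ (≤∧≢⇒< (least v∈C fits) (≢-sym v≢y))
... | inj₂ right = inj₂ right
Extract-greedy (pick {C} {Cs} {Cs′} {y} _ _ _ ex) (suc (suc d)) {v} v∈ e =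
  Extract-greedy ex (suc d) (subst (v ∈_) (row-suc (remove y C) Cs′ d) v∈) e

Extract-decrease : ∀ {Cs ys Cs′} → Extract Cs ys Cs′ → ∀ d {x y} →
  at ys d ≡ just x → at ys (suc d) ≡ just y → y ≤ x
Extract-decrease (none _) d e _ = contradiction (at-[] d) (just≢nothing e)
Extract-decrease (pick _ fits _ _) (suc zero) refl e = fits e
Extract-decrease (pick _ _ _ ex) (suc (suc d)) e f = Extract-decrease ex (suc d) e f

Extract-unique : ∀ {Cs ys Cs′} → Extract Cs ys Cs′ → All Unique Cs → All Unique Cs′
Extract-unique (none _) us = us
Extract-unique (pick {y = y} _ _ _ ex) (u ∷ us) = Unique.filter⁺ (λ z → ¬? (z ≟ y)) u ∷ Extract-unique ex us

-- For `t ≤ z` both counts drop by one, and for `t > y` neither does. For `z < t ≤ y` only the count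
-- of `C` drops, but there is one to spare: `z` itself is counted in `D` from `z` but not from `t`,
-- while `C` has no entry from `z` up to `y` exclusive, by minimality of `y`.
remove-dominates : ∀ {C D y z} → Unique C → Unique D → y ∈ C → z ∈ D → z ≤ y →
  (∀ {x} → x ∈ C → z ≤ x → y ≤ x) → Dominates C D → Dominates (remove y C) (remove z D)
remove-dominates {C} {D} {y} {z} uC uD y∈C z∈D z≤y least dom t with t ≤? z | t ≤? y
... | yes t≤z | yes t≤y = s≤s⁻¹ (subst₂ _≤_ (count-remove-≤ uD z∈D t≤z) (count-remove-≤ uC y∈C t≤y) (dom t))
... | yes t≤z | no  t≰y = contradiction (≤-trans t≤z z≤y) t≰y
... | no  t≰z | no  t≰y =
  subst₂ _≤_ (sym (count-remove-> D (≰⇒> t≰z))) (sym (count-remove-> C (≰⇒> t≰y))) (dom t)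
... | no  t≰z | yes t≤y = s≤s⁻¹ (begin
  suc (count t (remove z D)) ≡⟨ cong suc (count-remove-> D (≰⇒> t≰z)) ⟩
  suc (count t D)            ≤⟨ count-strict z∈D ≤-refl (≰⇒> t≰z) ⟩
  count z D                  ≤⟨ dom z ⟩
  count z C                  ≡⟨ cong length (filter-cong C id) ⟩
  count y C                  ≤⟨ count-antitone C t≤y ⟩
  count t C                  ≡⟨ count-remove-≤ uC y∈C t≤y ⟩
  suc (count t (remove y C)) ∎)
  where
  open ≤-Reasoning
  filter-cong : ∀ xs → (∀ {x} → x ∈ xs → x ∈ C) → filter (z ≤?_) xs ≡ filter (y ≤?_) xs
  filter-cong []       _ = refl
  filter-cong (x ∷ xs) f with z ≤? x | y ≤? x
  ... | yes p | yes q
    rewrite filter-accept (z ≤?_) {xs = xs} p | filter-accept (y ≤?_) {xs = xs} q =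
    cong (x ∷_) (filter-cong xs (f ∘ there))
  ... | yes p | no  q = contradiction (least (f (here refl)) p) q
  ... | no  p | yes q = contradiction (≤-trans z≤y q) p
  ... | no  p | no  q
    rewrite filter-reject (z ≤?_) {xs = xs} p | filter-reject (y ≤?_) {xs = xs} q =
    filter-cong xs (f ∘ there)

Extract-dominates : ∀ {Cs ys Cs′} → Extract Cs ys Cs′ → All Unique Cs → Linked Dominates Cs →
  Linked Dominates Cs′
Extract-dominates (none _) _ dom = dom
Extract-dominates (pick _ _ _ (none [])) _ _ = [-]
Extract-dominates (pick _ _ _ (none (refl ∷ empty))) (_ ∷ us) (_ ∷ doms) = (λ t → z≤n) ∷ doms
Extract-dominates (pick y∈C fits least ex@(pick z∈D _ _ _)) (uC ∷ us@(uD ∷ _)) (dom ∷ doms) =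
  remove-dominates uC uD y∈C z∈D (fits refl) (λ x∈C z≤x → least x∈C λ { refl → z≤x }) dom ∷
  Extract-dominates ex us doms

-- Domination at threshold 0 passes emptiness on from each column to the next.
no-columns : ∀ {Cs} → Linked Dominates Cs → row Cs 1 ≡ [] → ∀ d {v} → v ∉ row Cs d
no-columns {[]} _ _ d v∈ = case subst (_ ∈_) (row-[] d) v∈ of λ ()
no-columns {.[] ∷ Cs} dom refl zero ()
no-columns {.[] ∷ Cs} dom refl (suc zero) ()
no-columns {.[] ∷ Cs} dom refl (suc (suc d)) v∈ =
  no-columns (Linked.tail dom) (next dom) (suc d) (subst (_ ∈_) (row-suc [] Cs d) v∈)
  where
  next : ∀ {Cs} → Linked Dominates ([] ∷ Cs) → row Cs 1 ≡ []
  next [-] = refl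
  next {[] ∷ _}      _         = refl
  next {(x ∷ D) ∷ _} (dom ∷ _) = contradiction (dom 0) (<⇒≱ (count-positive {0} {x} {x ∷ D} (here refl) z≤n))

-- Assembling the extracted rows

record Realises (X : Filling) (Cs : Columns) : Set where
  field
    tableau   : Tableau X
    condition : KeyCondition X
    sound     : ∀ {r d v} → Cell X r d v → v ∈ row Cs d
    complete  : ∀ d {v} → v ∈ row Cs d → Occurs X v d

realises-empty : ∀ {Cs} → (∀ d {v} → v ∉ row Cs d) → Realises [] Cs
realises-empty empty = record
  { tableau   = tableau-[]
  ; condition = λ _ p → contradiction p cell-[]
  ; sound     = λ p → contradiction p cell-[]
  ; complete  = λ d v∈ → contradiction v∈ (empty d)
  }

realises-setRow : ∀ {Cs Cs′ X y ys} → Extract Cs (y ∷ ys) Cs′ → All (All (1 ≤_)) Cs →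
  Realises X Cs′ → Realises (setRow y (y ∷ ys) X) Cs
realises-setRow {Cs} {Cs′} {X} {y} {ys} ex Cs≥1 real = record
  { tableau = record
    { positive         = λ {_} {d} p → All.lookup (All-row⁻ [] Cs≥1 d) (sound′ p)
    ; rows-decrease    = rows-decrease′
    ; columns-distinct = columns-distinct′
    ; first-row-index  = first-row-index′
    }
  ; condition = condition′
  ; sound     = sound′
  ; complete  = complete′
  }
  where
  open Realises real
  open Tableau tableau
  R : List ℕ
  R = y ∷ ys
  X′ : Filling
  X′ = setRow y R X

  y≥1 : 1 ≤ y
  y≥1 = All.lookup (All-row⁻ [] Cs≥1 1) (Extract-at ex 1 refl)

  -- `y` has been deleted from column 1, where the entries of `X` are its row indices; so `setRow`
  -- overwrites no box.
  fresh : ∀ {r d v} → Cell X r d v → r ≢ y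
  fresh {d = zero}  (cell p) refl = contradiction p λ ()
  fresh {d = suc d} p        refl with _ , q ← cell-prefix {c = 0} p (s≤s z≤n) =
    proj₂ (Extract-∈⁻ ex 1 (sound q)) (cong just (sym (first-row-index q)))

  split : ∀ {r d v} → Cell X′ r d v → (r ≡ y × at R d ≡ just v) ⊎ (r ≢ y × Cell X r d v)
  split = setRow-cell {R} {X} y≥1

  same-key : ∀ {r} → r ≢ y → key X′ r ≡ key X r
  same-key n = cong row-key (setRow-other y R X n)

  new-key : key X′ y ≡ row-key R
  new-key = cong row-key (setRow-same R X y≥1)

  sound′ : ∀ {r d v} → Cell X′ r d v → v ∈ row Cs d
  sound′ {d = d} p with split p
  ... | inj₁ (_ , e) = Extract-at ex d e
  ... | inj₂ (_ , q) = proj₁ (Extract-∈⁻ ex d (sound q))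

  complete′ : ∀ d {v} → v ∈ row Cs d → Occurs X′ v d
  complete′ d v∈ with Extract-∈ ex d v∈
  ... | inj₁ v∈′ = let r , p = complete d v∈′ in r , setRow-old (fresh p) p
  ... | inj₂ e   = y , setRow-new y≥1 e

  rows-decrease′ : ∀ {r d a b} → Cell X′ r d a → Cell X′ r (suc d) b → b ≤ a
  rows-decrease′ {d = d} p q with split p | split q
  ... | inj₁ (_ , e)    | inj₁ (_ , f)    = Extract-decrease ex d e f
  ... | inj₁ (refl , _) | inj₂ (n , _)    = contradiction refl n
  ... | inj₂ (n , _)    | inj₁ (refl , _) = contradiction refl n
  ... | inj₂ (_ , p′)   | inj₂ (_ , q′)   = rows-decrease p′ q′

  columns-distinct′ : DistinctCells X′
  columns-distinct′ {c = d} p q with split p | split q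
  ... | inj₁ (refl , _) | inj₁ (refl , _) = refl
  ... | inj₁ (_ , e)    | inj₂ (_ , q′)   = contradiction e (proj₂ (Extract-∈⁻ ex d (sound q′)))
  ... | inj₂ (_ , p′)   | inj₁ (_ , f)    = contradiction f (proj₂ (Extract-∈⁻ ex d (sound p′)))
  ... | inj₂ (_ , p′)   | inj₂ (_ , q′)   = columns-distinct p′ q′

  first-row-index′ : ∀ {r v} → Cell X′ r 1 v → v ≡ r
  first-row-index′ p with split p
  ... | inj₁ (refl , refl) = refl
  ... | inj₂ (_ , q)       = first-row-index q

  -- A longer row would have a box in a column that `R` does not reach, though `R` reaches every
  -- nonempty column. For equal lengths a smaller last entry contradicts the greedy choice in the
  -- last column.
  extracted-first : ∀ {r c v} → Cell X r c v → ¬ key X r ≺ row-key R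
  extracted-first {r} p (inj₁ l)
    with _ , e ← Extract-longest ex (part X r) (proj₁ (Extract-∈⁻ ex (part X r) (sound (last-cell p)))) =
    contradiction (at-≤-length R (part X r) e) (<⇒≱ l)
  extracted-first {r} p (inj₂ (e , l))
    with z , f ← at-just R (length ys) ≤-refl
    with Extract-greedy ex (length R) (subst (λ d → proj₂ (key X r) ∈ row Cs′ d) e (sound (last-cell p))) f
  ... | inj₁ lt            = contradiction l (<⇒≯ (subst (_< _) (cong (fromMaybe 0) (sym f)) lt))
  ... | inj₂ (_ , g , _)   = contradiction (at-≤-length R (suc (length R)) g) (<-irrefl refl)

  condition′ : KeyCondition X′
  condition′ {r} {s} {c} prec p q with split p | split q
  ... | inj₁ (refl , _) | inj₁ (refl , _) = contradiction prec (≺-irrefl _)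
  ... | inj₁ (refl , e) | inj₂ (_ , q′) with Extract-greedy ex c (sound q′) e
  ...   | inj₁ lt           = inj₁ lt
  ...   | inj₂ (z , f , lt) = inj₂ (z , setRow-new y≥1 f , lt)
  condition′ {r} {s} {c} prec p q | inj₂ (n , p′) | inj₁ (refl , _) =
    contradiction (subst₂ _≺_ (same-key n) new-key prec) (extracted-first p′)
  condition′ {r} {s} {c} prec p q | inj₂ (n , p′) | inj₂ (m , q′)
    with condition (subst₂ _≺_ (same-key n) (same-key m) prec) p′ q′
  ... | inj₁ lt           = inj₁ lt
  ... | inj₂ (z , t , lt) = inj₂ (z , setRow-old n t , lt)

-- Each extraction deletes an entry of column 1, so the length of this column bounds the number of
-- rows; once it is empty, domination leaves nothing elsewhere.
fillRows-realises : ∀ n Cs → length (row Cs 1) ≤ n → All Unique Cs → Linked Dominates Cs →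
  All (All (1 ≤_)) Cs → Realises (fillRows n Cs) Cs
fillRows-realises zero Cs l us dom _ = realises-empty (no-columns dom (empty (row Cs 1) l))
  where
  empty : ∀ xs → length xs ≤ 0 → xs ≡ []
  empty [] _ = refl
fillRows-realises (suc n) Cs l us dom Cs≥1 with extractRow Cs | extractRow-spec Cs dom
... | []     , _   | none empty = realises-empty (empty-columns empty)
... | y ∷ ys , Cs′ | ex = realises-setRow ex Cs≥1
  (fillRows-realises n Cs′ (s≤s⁻¹ (≤-trans (shorter ex) l)) (Extract-unique ex us)
    (Extract-dominates ex us dom) (positive ex Cs≥1))
  where
  shorter : ∀ {Cs y ys Cs′} → Extract Cs (y ∷ ys) Cs′ → length (row Cs′ 1) < length (row Cs 1)
  shorter (pick {C} {y = y} y∈C _ _ _) =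
    filter-notAll (λ z → ¬? (z ≟ y)) C (Any.map (λ { refl ¬p → ¬p refl }) y∈C)
  positive : ∀ {Cs ys Cs′} → Extract Cs ys Cs′ → All (All (1 ≤_)) Cs → All (All (1 ≤_)) Cs′
  positive (none _) ps = ps
  positive (pick {y = y} _ _ _ ex) (p ∷ ps) = All.filter⁺ (λ z → ¬? (z ≟ y)) p ∷ positive ex ps

length-first-column : ∀ V → length (column V 1) ≤ sum (map length V)
length-first-column []            = z≤n
length-first-column ([] ∷ V)      = length-first-column V
length-first-column ((_ ∷ R) ∷ V) = s≤s (≤-trans (length-first-column V) (m≤n+m _ (length R)))

ψ-image : ∀ {V} → RevSSYT V → QuasiKey₁ (ψ V) × SameColumns (ψ V) V
ψ-image {V} v = KeyCondition⇒QuasiKey₁ tableau condition ,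
  (λ { {_} {c} (_ , p) → ∈⇒Occurs {V} c (sound p) }) , λ {_} {c} o → complete c (Occurs⇒∈ {V} c o)
  where
  open Realises (fillRows-realises (sum (map length V)) (columns V)
    (subst (λ C → length C ≤ sum (map length V)) (sym (row-columns V 1)) (length-first-column V))
    (All.map decreasing⇒unique (columns-decreasing v)) (columns-dominate v) (columns-positive v))

theorem5p12 : RestrictsToBijection ψ QRevSSYT QQuasiKey₁ × RestrictsToBijection Γ QRevSSYT QSSF
theorem5p12 =
  restricts-to-bijection QuasiKey₁-determined ψ-image , restricts-to-bijection ASSF-determined Γ-image
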